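{- Let $\kappa\leq\lambda$ be infinite cardinals with $\kappa$ regular, and assume $\lambda>\mathfrak{c}=2^{\aleph_0}$. The following are equivalent: (1) There is a continuous weak $\lambda$-measure space $(X,\mathfrak{M},\mu)$ for some $X\subseteq{}^{\kappa}\lambda$ of weight $\lambda$ such that $\mu$ takes values in $[0,1]$. (2) For every non-$\lambda$-Lindelöf space $X\subseteq{}^{\kappa}\lambda$ of weight $\lambda$ there is $\mu:\mathscr{P}(X)\to[0,1]$ such that $(X,\mathscr{P}(X),\mu)$ is a continuous weak $\lambda$-measure space. (3) $\lambda$ is measurable (i.e. uncountable and carrying a $\lambda$-complete non-principal ultrafilter).
   Context: **Topology.** ${}^{\kappa}\lambda$ is the set of sequences of elements of $\lambda$ of length $\kappa$, with the bounded topology, generated by the cones $\mathbf{N}_s=\{x\in{}^{\kappa}\lambda\mid s\subseteq x\}$ for $s\in{}^{<\kappa}\lambda=\bigcup_{\alpha<\kappa}{}^{\alpha}\lambda$. Subsets carry the subspace topology. A space is $\lambda$-Lindelöf if every open cover has a subcover of size strictly less than $\lambda$. **Measures with values in $[0,1]$.** Here $[0,1]$ is regarded as a subset of $[0,\infty]$ with the usual order and addition, and $\sum$ denotes the usual (unordered) sum of non-negative reals, i.e. the supremum of all finite partial sums. A weak $\lambda$-measure space $(X,\mathfrak{M},\mu)$ with $\mu$ taking values in $[0,1]$ consists of a topological space $X$, a family $\mathfrak{M}$ of subsets of $X$ closed under unions of size $<\lambda$ and containing all open subsets of $X$, and a partial function $\mu:\mathscr{P}(X)\to[0,1]$ with $\mathfrak{M}\subseteq\mathrm{dom}(\mu)$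 such that: (M1) $\mu(\emptyset)=0$; (M2) $\mu(X)>0$; (M3) $A\subseteq B$ implies $\mu(A)\leq\mu(B)$ for all $A,B\in\mathfrak{M}$; (M4) for every family $(A_i)_{i<\gamma}$ of pairwise disjoint sets of $\mathfrak{M}$ of length an ordinal $\gamma<\lambda$, $\mu(\bigcup_{i<\gamma}A_i)=\sum_{i<\gamma}\mu(A_i)$; (M5) for every $x\in X$ with $\{x\}\in\mathfrak{M}$ and every open local basis $\{A_i\mid i<\gamma\}$ at $x$ with $\gamma<\lambda$, $\mu(\{x\})=\inf_{i<\gamma}\mu(A_i)$. It is continuous if $\{x\}\in\mathfrak{M}$ and $\mu(\{x\})=0$ for every $x\in X$. -}

module Defs where

open import Level using (0ℓ)
open import Axiom.ExcludedMiddle using (ExcludedMiddle)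
open import Data.Bool.Base using (Bool; T)
open import Data.Empty using (⊥; ⊥-elim)
open import Data.List.Base using (List; map; foldr)
open import Data.List.Relation.Unary.Unique.Propositional using (Unique)
open import Data.Nat.Base using (ℕ; zero)
open import Data.Product.Base using (Σ; Σ-syntax; ∃-syntax; _×_; _,_; proj₁; proj₂)
open import Data.Rational.Base as ℚ using (ℚ; 0ℚ; 1ℚ)
import Data.Rational.Properties as ℚ
open import Data.Sum.Base using (_⊎_; inj₁; inj₂)
open import Data.Unit.Base using (⊤; tt)
open import Function.Base using (_∘_; id)
open import Function.Bundles using (_↣_; _⤖_; _⇔_; mk⇔; Equivalence; Injection)
open import Induction.WellFounded using (WellFounded)
open import Relation.Binary.Core using (Rel)
open import Relation.Binary.Definitions using (tri<; tri≈; tri>)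
open import Relation.Binary.PropositionalEquality
  using (_≡_; _≢_; refl; sym; trans; cong; subst)
open import Relation.Binary.Structures using (IsStrictTotalOrder)
open import Relation.Nullary.Decidable using (isYes; toWitness; fromWitness)
open import Relation.Nullary.Negation using (¬_)

-- The ambient theory is classical set theory with choice.  stdlib's
-- ExcludedMiddle decides every type, not only every proposition, so besides
-- classical logic it yields choice: from ∀ x → ¬ ¬ B x one gets ∀ x → B x.

module Classical (em : ExcludedMiddle 0ℓ) where

  -- Under em every predicate is equivalent to a Bool-valued one, so 𝒫 A is the
  -- full power set.  Bool values make membership proof-irrelevant, so El B has
  -- exactly one element for each member of B, and keep 𝒫 A small.

  𝒫 : Set → Set
  𝒫 A = A → Bool

  infix 4 _∈_ _∉_ _⊆_

  _∈_ : {A : Set} → A → 𝒫 A → Set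
  x ∈ B = T (B x)

  _∉_ : {A : Set} → A → 𝒫 A → Set
  x ∉ B = ¬ (x ∈ B)

  _⊆_ : {A : Set} → 𝒫 A → 𝒫 A → Set
  B ⊆ C = ∀ x → x ∈ B → x ∈ C

  El : {A : Set} → 𝒫 A → Set
  El {A} B = Σ[ x ∈ A ] x ∈ B

  ⟪_⟫ : {A : Set} → (A → Set) → 𝒫 A
  ⟪ P ⟫ x = isYes (em {P x})

  ∈-intro : {A : Set} (P : A → Set) {x : A} → P x → x ∈ ⟪ P ⟫
  ∈-intro P = fromWitness

  ∈-elim : {A : Set} (P : A → Set) {x : A} → x ∈ ⟪ P ⟫ → P x
  ∈-elim P = toWitness

  ∅ : {A : Set} → 𝒫 A
  ∅ = ⟪ (λ _ → ⊥) ⟫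

  full : {A : Set} → 𝒫 A
  full = ⟪ (λ _ → ⊤) ⟫

  ｛_｝ : {A : Set} → A → 𝒫 A
  ｛ a ｝ = ⟪ (λ x → x ≡ a) ⟫

  ∁ : {A : Set} → 𝒫 A → 𝒫 A
  ∁ B = ⟪ (λ x → x ∉ B) ⟫

  infixr 7 _∩_

  _∩_ : {A : Set} → 𝒫 A → 𝒫 A → 𝒫 A
  B ∩ C = ⟪ (λ x → x ∈ B × x ∈ C) ⟫

  ⋃ : {I A : Set} → (I → 𝒫 A) → 𝒫 A
  ⋃ {I} B = ⟪ (λ x → ∃[ i ] x ∈ B i) ⟫

  ⋂ : {I A : Set} → (I → 𝒫 A) → 𝒫 A
  ⋂ {I} B = ⟪ (λ x → ∀ i → x ∈ B i) ⟫

  infix 4 _≺_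

  _≺_ : Set → Set → Set
  A ≺ B = (A ↣ B) × ¬ (B ↣ A)

  -- Cardinals are initial ordinals: well-orders that do not inject into any
  -- of their proper initial segments.

  record InfiniteCardinal : Set₁ where
    infix 4 _<_
    field
      Carrier            : Set
      _<_                : Rel Carrier 0ℓ
      isStrictTotalOrder : IsStrictTotalOrder _≡_ _<_
      wellFounded        : WellFounded _<_

    open IsStrictTotalOrder isStrictTotalOrder public using (compare) renaming (trans to <-trans)

    Below : Carrier → Set
    Below γ = El ⟪ (λ i → i < γ) ⟫

    field
      initial  : ∀ γ → ¬ (Carrier ↣ Below γ)
      infinite : ℕ ↣ Carrier

  -- The ordinals γ < λ are the elements of the carrier, and Below γ is the set
  -- of ordinals smaller than γ; families of length γ are functions on Below γ.

  open InfiniteCardinal using (Below) renaming (Carrier to ∣_∣)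

  _≤ᶜ_ : InfiniteCardinal → InfiniteCardinal → Set
  κ ≤ᶜ ƛ = ∣ κ ∣ ↣ ∣ ƛ ∣

  IsRegular : InfiniteCardinal → Set
  IsRegular κ = ∀ γ (f : Below κ γ → ∣ κ ∣) → ∃[ β ] (∀ i → f i < β)
    where open InfiniteCardinal κ using (_<_)

  AboveContinuum : InfiniteCardinal → Set
  AboveContinuum ƛ = (ℕ → Bool) ≺ ∣ ƛ ∣

  record Topology (X : Set) : Set where
    field
      opens  : 𝒫 (𝒫 X)
      open-∅ : ∅ ∈ opens
      open-X : full ∈ opens
      open-∩ : ∀ U V → U ∈ opens → V ∈ opens → U ∩ V ∈ opens
      open-⋃ : ∀ (𝒰 : 𝒫 (𝒫 X)) → 𝒰 ⊆ opens → ⋃ {El 𝒰} proj₁ ∈ opens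

  open Topology

  UnionOf : {I X : Set} → (I → 𝒫 X) → 𝒫 X → Set
  UnionOf B U = ∀ x → x ∈ U → ∃[ i ] (x ∈ B i × B i ⊆ U)

  generatedBy : {I X : Set} (B : I → 𝒫 X) → (∀ x → ∃[ i ] x ∈ B i) →
                (∀ i j → UnionOf B (B i ∩ B j)) → Topology X
  generatedBy {I} {X} B cover inter = record
    { opens  = ⟪ UnionOf B ⟫
    ; open-∅ = ∈-intro (UnionOf B) λ x x∈∅ → ⊥-elim (∈-elim (λ _ → ⊥) {x} x∈∅)
    ; open-X = ∈-intro (UnionOf B) λ x _ →
        proj₁ (cover x) , proj₂ (cover x) , λ y _ → ∈-intro (λ _ → ⊤) {y} tt
    ; open-∩ = λ U V oU oV → ∈-intro (UnionOf B) (meet U V (∈-elim (UnionOf B) oU) (∈-elim (UnionOf B) oV))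
    ; open-⋃ = λ 𝒰 o → ∈-intro (UnionOf B) (union 𝒰 o)
    }
    where
    meet : ∀ U V → UnionOf B U → UnionOf B V → UnionOf B (U ∩ V)
    meet U V oU oV x x∈ with ∈-elim (λ y → y ∈ U × y ∈ V) x∈
    ... | x∈U , x∈V with oU x x∈U | oV x x∈V
    ... | i , x∈Bi , Bi⊆U | j , x∈Bj , Bj⊆V
      with inter i j x (∈-intro (λ y → y ∈ B i × y ∈ B j) (x∈Bi , x∈Bj))
    ... | k , x∈Bk , Bk⊆ = k , x∈Bk , λ y y∈ →
      let y∈ij = ∈-elim (λ z → z ∈ B i × z ∈ B j) (Bk⊆ y y∈)
      in ∈-intro (λ z → z ∈ U × z ∈ V) (Bi⊆U y (proj₁ y∈ij) , Bj⊆V y (proj₂ y∈ij))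

    union : ∀ 𝒰 → 𝒰 ⊆ ⟪ UnionOf B ⟫ → UnionOf B (⋃ {El 𝒰} proj₁)
    union 𝒰 o x x∈ with ∈-elim (λ y → Σ[ U ∈ El 𝒰 ] y ∈ proj₁ U) x∈
    ... | (U , U∈) , x∈U with ∈-elim (UnionOf B) (o U U∈) x x∈U
    ... | i , x∈Bi , Bi⊆U = i , x∈Bi , λ y y∈ →
      ∈-intro (λ z → Σ[ V ∈ El 𝒰 ] z ∈ proj₁ V) ((U , U∈) , Bi⊆U y y∈)

  Trace : {A : Set} (X : 𝒫 A) → 𝒫 A → 𝒫 (El X) → Set
  Trace X U V = ∀ x → (proj₁ x ∈ U) ⇔ (x ∈ V)

  subspace : {A : Set} → Topology A → (X : 𝒫 A) → Topology (El X)
  subspace {A} τ X = record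
    { opens  = ⟪ IsOpen ⟫
    ; open-∅ = ∈-intro IsOpen (∅ , open-∅ τ , λ x →
        mk⇔ (λ p → ⊥-elim (∈-elim (λ _ → ⊥) {proj₁ x} p)) (λ p → ⊥-elim (∈-elim (λ _ → ⊥) {x} p)))
    ; open-X = ∈-intro IsOpen (full , open-X τ , λ x → mk⇔ (λ _ → f∈ x) (λ _ → f∈ (proj₁ x)))
    ; open-∩ = λ V W oV oW → ∈-intro IsOpen (meet V W (∈-elim IsOpen oV) (∈-elim IsOpen oW))
    ; open-⋃ = λ 𝒱 o → ∈-intro IsOpen (union 𝒱 o)
    }
    where
    open Equivalence using (to; from)

    f∈ : {B : Set} (x : B) → x ∈ full
    f∈ x = ∈-intro (λ _ → ⊤) {x} tt

    IsOpen : 𝒫 (El X) → Set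
    IsOpen V = ∃[ U ] (U ∈ opens τ × Trace X U V)

    meet : ∀ V W → IsOpen V → IsOpen W → IsOpen (V ∩ W)
    meet V W (U₁ , o₁ , t₁) (U₂ , o₂ , t₂) = U₁ ∩ U₂ , open-∩ τ U₁ U₂ o₁ o₂ , λ x → mk⇔
      (λ p → let q = ∈-elim (λ y → y ∈ U₁ × y ∈ U₂) p
             in ∈-intro (λ y → y ∈ V × y ∈ W) (to (t₁ x) (proj₁ q) , to (t₂ x) (proj₂ q)))
      (λ p → let q = ∈-elim (λ y → y ∈ V × y ∈ W) p
             in ∈-intro (λ y → y ∈ U₁ × y ∈ U₂) (from (t₁ x) (proj₁ q) , from (t₂ x) (proj₂ q)))

    union : ∀ 𝒱 → 𝒱 ⊆ ⟪ IsOpen ⟫ → IsOpen (⋃ {El 𝒱} proj₁)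
    union 𝒱 o = ⋃ {El 𝒰} proj₁ , open-⋃ τ 𝒰 (λ U p → proj₁ (∈-elim P p)) , λ x → mk⇔
      (λ p → let ((U , U∈) , x∈U) = ∈-elim (λ y → Σ[ U ∈ El 𝒰 ] y ∈ proj₁ U) p
                 (_ , V , V∈ , t) = ∈-elim P U∈
             in ∈-intro (λ y → Σ[ W ∈ El 𝒱 ] y ∈ proj₁ W) ((V , V∈) , to (t x) x∈U))
      (λ p → let ((V , V∈) , x∈V) = ∈-elim (λ y → Σ[ W ∈ El 𝒱 ] y ∈ proj₁ W) p
                 (U , oU , t)     = ∈-elim IsOpen (o V V∈)
             in ∈-intro (λ y → Σ[ U ∈ El 𝒰 ] y ∈ proj₁ U)
                  ((U , ∈-intro P (oU , V , V∈ , t)) , from (t x) x∈V))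
      where
      P : 𝒫 A → Set
      P U = U ∈ opens τ × (∃[ V ] (V ∈ 𝒱 × Trace X U V))

      𝒰 : 𝒫 (𝒫 A)
      𝒰 = ⟪ P ⟫

  IsBase : {X : Set} → Topology X → 𝒫 (𝒫 X) → Set
  IsBase τ ℬ = ℬ ⊆ opens τ ×
    (∀ U → U ∈ opens τ → UnionOf {El ℬ} proj₁ U)

  HasWeight : {X : Set} → Topology X → InfiniteCardinal → Set
  HasWeight {X} τ ƛ =
    (∃[ ℬ ] (IsBase τ ℬ × (∣ ƛ ∣ ⤖ El ℬ))) ×
    (∀ ℬ → IsBase τ ℬ → ∣ ƛ ∣ ↣ El ℬ)

  Covers : {X : Set} → 𝒫 (𝒫 X) → Set
  Covers 𝒰 = ∀ x → ∃[ U ] (U ∈ 𝒰 × x ∈ U)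

  IsLindelöf : {X : Set} → InfiniteCardinal → Topology X → Set
  IsLindelöf ƛ τ = ∀ 𝒰 → 𝒰 ⊆ opens τ → Covers 𝒰 →
    ∃[ 𝒱 ] (𝒱 ⊆ 𝒰 × Covers 𝒱 × El 𝒱 ≺ ∣ ƛ ∣)

  IsLocalBasis : {I X : Set} → Topology X → X → (I → 𝒫 X) → Set
  IsLocalBasis τ x A =
    (∀ i → A i ∈ opens τ × x ∈ A i) ×
    (∀ U → U ∈ opens τ → x ∈ U → ∃[ i ] A i ⊆ U)

  module _ (κ ƛ : InfiniteCardinal) where
    private module κ = InfiniteCardinal κ

    Seq : Set
    Seq = ∣ κ ∣ → ∣ ƛ ∣

    <Seq : Set
    <Seq = Σ[ α ∈ ∣ κ ∣ ] (Below κ α → ∣ ƛ ∣)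

    _⊏_ : <Seq → Seq → Set
    (α , s) ⊏ x = ∀ i → s i ≡ x (proj₁ i)

    cone : <Seq → 𝒫 Seq
    cone s = ⟪ (λ x → s ⊏ x) ⟫

    boundedTopology : Topology Seq
    boundedTopology = generatedBy cone
      (λ x → let s = Injection.to κ.infinite zero , x ∘ proj₁ in
             s , ∈-intro (λ y → s ⊏ y) {x} λ _ → refl)
      inter
      where
      smaller : ∀ s t x → s ⊏ x → (∀ y → t ⊏ y → s ⊏ y) → x ∈ cone t →
                ∃[ u ] (x ∈ cone u × cone u ⊆ (cone s ∩ cone t))
      smaller s t x _ h x∈t = t , x∈t , λ y y∈t →
        ∈-intro (λ z → z ∈ cone s × z ∈ cone t)
          (∈-intro (λ z → s ⊏ z) (h y (∈-elim (λ z → t ⊏ z) y∈t)) , y∈t)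

      extend : ∀ {α β} (s : Below κ α → ∣ ƛ ∣) (t : Below κ β → ∣ ƛ ∣) x →
               (∀ {i} → i κ.< α → i κ.< β) → (α , s) ⊏ x → (β , t) ⊏ x →
               ∀ y → (β , t) ⊏ y → (α , s) ⊏ y
      extend {α} {β} s t x incl sx tx y ty (i , i<α) =
        trans (sx (i , i<α)) (trans (sym (tx j)) (ty j))
        where j = i , ∈-intro (λ k → k κ.< β) (incl (∈-elim (λ k → k κ.< α) i<α))

      inter : ∀ s t → UnionOf cone (cone s ∩ cone t)
      inter (α , s) (β , t) x x∈ with ∈-elim (λ z → z ∈ cone (α , s) × z ∈ cone (β , t)) x∈
      ... | x∈s , x∈t with κ.compare α β
      ... | tri< α<β _ _ = smaller (α , s) (β , t) x s⊏x
              (extend s t x (λ i<α → κ.<-trans i<α α<β) s⊏x t⊏x) x∈t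
        where s⊏x = ∈-elim (λ z → (α , s) ⊏ z) x∈s
              t⊏x = ∈-elim (λ z → (β , t) ⊏ z) x∈t
      ... | tri≈ _ refl _ = smaller (α , s) (β , t) x s⊏x
              (extend s t x id s⊏x t⊏x) x∈t
        where s⊏x = ∈-elim (λ z → (α , s) ⊏ z) x∈s
              t⊏x = ∈-elim (λ z → (β , t) ⊏ z) x∈t
      ... | tri> _ _ β<α with smaller (β , t) (α , s) x t⊏x
              (extend t s x (λ i<β → κ.<-trans i<β β<α) t⊏x s⊏x) x∈s
        where s⊏x = ∈-elim (λ z → (α , s) ⊏ z) x∈s
              t⊏x = ∈-elim (λ z → (β , t) ⊏ z) x∈t
      ... | u , x∈u , u⊆ = u , x∈u , λ y y∈ →
        let (y∈t , y∈s) = ∈-elim (λ z → z ∈ cone (β , t) × z ∈ cone (α , s)) (u⊆ y y∈)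
        in ∈-intro (λ z → z ∈ cone (α , s) × z ∈ cone (β , t)) (y∈s , y∈t)

    space : (X : 𝒫 Seq) → Topology (El X)
    space = subspace boundedTopology

  -- Extended non-negative reals as left Dedekind cuts: x is represented by
  -- { q ∈ ℚ | q < x }, and ∞ by all of ℚ.

  record [0,∞] : Set where
    field
      cut      : 𝒫 ℚ
      negative : ∀ {q} → q ℚ.< 0ℚ → q ∈ cut
      downward : ∀ {p q} → p ℚ.< q → q ∈ cut → p ∈ cut
      rounded  : ∀ {q} → q ∈ cut → ∃[ r ] (q ℚ.< r × r ∈ cut)

  open [0,∞]

  infix 4 _≤_ _≈_
  infixl 6 _+_

  _≤_ : [0,∞] → [0,∞] → Set
  x ≤ y = cut x ⊆ cut y

  _≈_ : [0,∞] → [0,∞] → Set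
  x ≈ y = x ≤ y × y ≤ x

  fromℚ : (r : ℚ) → 0ℚ ℚ.≤ r → [0,∞]
  fromℚ r 0≤r = record
    { cut      = ⟪ (λ q → q ℚ.< r) ⟫
    ; negative = λ q<0 → ∈-intro (λ q → q ℚ.< r) (ℚ.<-≤-trans q<0 0≤r)
    ; downward = λ p<q q∈ → ∈-intro (λ q → q ℚ.< r) (ℚ.<-trans p<q (∈-elim (λ q → q ℚ.< r) q∈))
    ; rounded  = λ q∈ → let (m , q<m , m<r) = ℚ.<-dense (∈-elim (λ q → q ℚ.< r) q∈)
                        in m , q<m , ∈-intro (λ q → q ℚ.< r) m<r
    }

  𝟘 : [0,∞]
  𝟘 = fromℚ 0ℚ ℚ.≤-refl

  𝟙 : [0,∞]
  𝟙 = fromℚ 1ℚ (ℚ.nonNegative⁻¹ 1ℚ)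

  _+_ : [0,∞] → [0,∞] → [0,∞]
  x + y = record
    { cut      = ⟪ Sum ⟫
    ; negative = λ {q} q<0 → let (m , q<m , m<0) = ℚ.<-dense q<0 in
        ∈-intro Sum (q ℚ.- m , m
                    , negative x (subst (q ℚ.- m ℚ.<_) (ℚ.+-inverseʳ m) (ℚ.+-monoˡ-< (ℚ.- m) q<m))
                    , negative y m<0
                    , sym (minus-plus q m))
    ; downward = λ {p} p<q q∈ → let (a , b , a∈ , b∈ , q≡a+b) = ∈-elim Sum q∈ in
        ∈-intro Sum (p ℚ.- b , b
                    , downward x (subst (p ℚ.- b ℚ.<_) (trans (cong (ℚ._- b) q≡a+b) (plus-minus a b))
                                        (ℚ.+-monoˡ-< (ℚ.- b) p<q)) a∈
                    , b∈
                    , sym (minus-plus p b))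
    ; rounded  = λ q∈ → let (a , b , a∈ , b∈ , q≡a+b) = ∈-elim Sum q∈
                            (a′ , a<a′ , a′∈) = rounded x a∈ in
        a′ ℚ.+ b , subst (ℚ._< a′ ℚ.+ b) (sym q≡a+b) (ℚ.+-monoˡ-< b a<a′)
                 , ∈-intro Sum (a′ , b , a′∈ , b∈ , refl)
    }
    where
    Sum : ℚ → Set
    Sum q = ∃[ a ] ∃[ b ] (a ∈ cut x × b ∈ cut y × q ≡ a ℚ.+ b)

    minus-plus : ∀ q m → (q ℚ.- m) ℚ.+ m ≡ q
    minus-plus q m = trans (ℚ.+-assoc q (ℚ.- m) m)
      (trans (cong (q ℚ.+_) (ℚ.+-inverseˡ m)) (ℚ.+-identityʳ q))

    plus-minus : ∀ a b → (a ℚ.+ b) ℚ.- b ≡ a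
    plus-minus a b = trans (ℚ.+-assoc a b (ℚ.- b))
      (trans (cong (a ℚ.+_) (ℚ.+-inverseʳ b)) (ℚ.+-identityʳ a))

  ⨆ : {I : Set} → (I → [0,∞]) → [0,∞]
  ⨆ {I} x = record
    { cut      = ⟪ P ⟫
    ; negative = λ q<0 → ∈-intro P (inj₁ q<0)
    ; downward = λ p<q q∈ → ∈-intro P (down p<q (∈-elim P q∈))
    ; rounded  = λ q∈ → let (r , q<r , r∈) = round (∈-elim P q∈) in r , q<r , ∈-intro P r∈
    }
    where
    P : ℚ → Set
    P q = q ℚ.< 0ℚ ⊎ (∃[ i ] q ∈ cut (x i))

    down : ∀ {p q} → p ℚ.< q → P q → P p
    down p<q (inj₁ q<0)      = inj₁ (ℚ.<-trans p<q q<0)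
    down p<q (inj₂ (i , q∈)) = inj₂ (i , downward (x i) p<q q∈)

    round : ∀ {q} → P q → ∃[ r ] (q ℚ.< r × P r)
    round (inj₁ q<0)      = let (m , q<m , m<0) = ℚ.<-dense q<0 in m , q<m , inj₁ m<0
    round (inj₂ (i , q∈)) = let (r , q<r , r∈) = rounded (x i) q∈ in r , q<r , inj₂ (i , r∈)

  -- The infimum as the supremum of all lower bounds.

  ⨅ : {I : Set} → (I → [0,∞]) → [0,∞]
  ⨅ {I} x = ⨆ {Σ[ v ∈ [0,∞] ] (∀ i → v ≤ x i)} proj₁

  -- Finite subsets of I are enumerated by the duplicate-free lists.

  ∑ : {I : Set} → (I → [0,∞]) → [0,∞]
  ∑ {I} x = ⨆ {Σ[ is ∈ List I ] Unique is} (λ (is , _) → foldr _+_ 𝟘 (map x is))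

  [0,1] : Set
  [0,1] = Σ[ x ∈ [0,∞] ] x ≤ 𝟙

  -- A partial function 𝒫 X → [0,1] is given by its domain and its values there.
  -- Since every set of size < λ is enumerated by an ordinal γ < λ, closure under
  -- unions of size < λ is expressed with families of length γ.

  record IsWeakMeasureSpace
    (ƛ : InfiniteCardinal) {X : Set} (τ : Topology X)
    (𝔐 dom : 𝒫 (𝒫 X)) (μ : ∀ A → A ∈ dom → [0,1]) : Set where
    field
      open⊆𝔐 : opens τ ⊆ 𝔐
      𝔐-⋃    : ∀ γ (A : Below ƛ γ → 𝒫 X) → (∀ i → A i ∈ 𝔐) → ⋃ A ∈ 𝔐
      𝔐⊆dom  : 𝔐 ⊆ dom

    measure : ∀ A → A ∈ 𝔐 → [0,∞]
    measure A A∈ = proj₁ (μ A (𝔐⊆dom A A∈))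

    field
      M1 : measure ∅ (open⊆𝔐 ∅ (open-∅ τ)) ≈ 𝟘
      M2 : ¬ (measure full (open⊆𝔐 full (open-X τ)) ≤ 𝟘)
      M3 : ∀ A B (a : A ∈ 𝔐) (b : B ∈ 𝔐) → A ⊆ B → measure A a ≤ measure B b
      M4 : ∀ γ (A : Below ƛ γ → 𝒫 X) (a : ∀ i → A i ∈ 𝔐) →
           (∀ i j → i ≢ j → ∀ x → ¬ (x ∈ A i × x ∈ A j)) →
           measure (⋃ A) (𝔐-⋃ γ A a) ≈ ∑ (λ i → measure (A i) (a i))
      M5 : ∀ x (m : ｛ x ｝ ∈ 𝔐) γ (A : Below ƛ γ → 𝒫 X) (lb : IsLocalBasis τ x A) →
           measure ｛ x ｝ m ≈
           ⨅ (λ i → measure (A i) (open⊆𝔐 (A i) (proj₁ (proj₁ lb i))))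

  record IsContinuousWeakMeasureSpace
    (ƛ : InfiniteCardinal) {X : Set} (τ : Topology X)
    (𝔐 dom : 𝒫 (𝒫 X)) (μ : ∀ A → A ∈ dom → [0,1]) : Set where
    field
      isWeakMeasureSpace : IsWeakMeasureSpace ƛ τ 𝔐 dom μ
    open IsWeakMeasureSpace isWeakMeasureSpace public
    field
      singleton∈𝔐    : ∀ x → ｛ x ｝ ∈ 𝔐
      singleton-null : ∀ x → measure ｛ x ｝ (singleton∈𝔐 x) ≈ 𝟘

  record IsUltrafilter {A : Set} (𝒰 : 𝒫 (𝒫 A)) : Set where
    field
      full∈  : full ∈ 𝒰
      ∅∉     : ∅ ∉ 𝒰
      upward : ∀ B C → B ⊆ C → B ∈ 𝒰 → C ∈ 𝒰
      ∩∈     : ∀ B C → B ∈ 𝒰 → C ∈ 𝒰 → B ∩ C ∈ 𝒰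
      ultra  : ∀ B → B ∈ 𝒰 ⊎ ∁ B ∈ 𝒰

  IsPrincipal : {A : Set} → 𝒫 (𝒫 A) → Set
  IsPrincipal {A} 𝒰 = ∃[ a ] (∀ B → (B ∈ 𝒰) ⇔ (a ∈ B))

  IsComplete : {A : Set} → InfiniteCardinal → 𝒫 (𝒫 A) → Set
  IsComplete {A} ƛ 𝒰 = ∀ γ (B : Below ƛ γ → 𝒫 A) → (∀ i → B i ∈ 𝒰) → ⋂ B ∈ 𝒰

  IsMeasurable : InfiniteCardinal → Set
  IsMeasurable ƛ = (ℕ ≺ ∣ ƛ ∣) ×
    (Σ[ 𝒰 ∈ 𝒫 (𝒫 ∣ ƛ ∣) ] (IsUltrafilter 𝒰 × ¬ IsPrincipal 𝒰 × IsComplete ƛ 𝒰))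

{-# OPTIONS --safe #-}
-- From a measure to an ultrafilter.  Call a set null if its measure is 0.  If λ
-- (or fewer) pairwise disjoint null open sets have a non-null union, then μ induces
-- a λ-additive measure on all subsets of the index set which vanishes at points.
-- It has an atom: otherwise, repeated splitting produces 2^ω < λ branches, one of
-- which is not null, and the pieces removed along it are infinitely many disjoint
-- sets of measure bounded away from 0.  An atom yields a λ-complete non-principal
-- ultrafilter.
-- Such null open sets exist.  If the union of the null cones is not null, take the
-- maximal null cones.  If it is null, then it is not all of X.  For κ > ω take
-- a point x outside it: from some level on, the cones around x lose only null sets,
-- so by the nullity of {x} one can take the sets of points splitting from x at
-- level β < κ.  The case κ = ω is impossible: a level has only countably many cones
-- of positive measure, so at most 2^ω < λ points lie outside the union of the null
-- cones, and X would be null.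
-- From an ultrafilter to a measure.  The maximal cones inside members of a cover
-- without small subcover form a clopen partition into λ pieces.  Picking one point
-- in each of λ many pieces and pushing the ultrafilter forward gives a two-valued
-- measure, for which every point has a null neighbourhood.

module Submission where

open import Defs
open import Level using (0ℓ)
open import Axiom.ExcludedMiddle using (ExcludedMiddle)
open import Axiom.Extensionality.Propositional using (Extensionality)
open import Data.Product.Base using (_×_; ∃-syntax; Σ-syntax)
open import Function.Bundles using (_⇔_)
open import Relation.Nullary.Negation using (¬_)

open import Axiom.Extensionality.Propositional using (implicit-extensionality)
open import Data.Bool.Base using (Bool; true; false; not; T)
open import Data.Bool.Properties using (T-irrelevant)
open import Data.Empty using (⊥; ⊥-elim)
import Algebra.Properties.AbelianGroup
import Data.Integer.Base as ℤ
import Data.Integer.Properties as ℤ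
open import Data.Integer.Tactic.RingSolver using (solve-∀)
open import Data.List.Base using (List; []; _∷_; map; foldr; length; upTo)
open import Data.List.Properties using (length-map; length-upTo)
open import Data.List.Relation.Unary.All as All using (All; []; _∷_)
open import Data.List.Relation.Unary.AllPairs using ([]; _∷_)
open import Data.List.Relation.Unary.Unique.Propositional using (Unique)
open import Data.List.Relation.Unary.Unique.Propositional.Properties using (map⁺; upTo⁺)
open import Data.Maybe.Base using (Maybe; just; nothing)
open import Data.Maybe.Properties using (just-injective)
open import Data.Nat.Base as ℕ using (ℕ; zero; suc; z≤n; s≤s; _≡ᵇ_)
open import Data.Nat.Coprimality using (1-coprimeTo)
import Data.Nat.Induction as ℕ
import Data.Nat.Properties as ℕ
open import Data.Product.Base using (∃; _,_; proj₁; proj₂)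
open import Data.Rational.Base as ℚ using (ℚ; mkℚ; 0ℚ; 1ℚ)
import Data.Rational.Properties as ℚ
import Data.Rational.Unnormalised.Base as ℚᵘ
import Data.Rational.Unnormalised.Properties as ℚᵘ
open import Data.Sum.Base using (_⊎_; inj₁; inj₂)
open import Data.Unit.Base using (⊤; tt)
open import Function.Base using (_∘_; id)
open import Function.Bundles using (_↣_; _⤖_; mk↣; mk⤖; mk⇔; Injection; Bijection; Equivalence)
open import Function.Construct.Composition using (_↣-∘_)
open import Function.Construct.Symmetry using (⤖-sym)
open import Induction.WellFounded using (WellFounded; WfRec; module FixPoint; module All)
open import Relation.Binary.Core using (Rel)
open import Relation.Binary.Definitions using (Tri; tri<; tri≈; tri>)
open import Relation.Binary.PropositionalEquality
open import Relation.Binary.Structures using (IsStrictTotalOrder)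
open import Relation.Nullary.Decidable.Core using (yes; no)

open Algebra.Properties.AbelianGroup ℚ.+-0-abelianGroup using (//-rightDividesˡ; xyx⁻¹≈y)

Disjoint : {I X : Set} → (I → X → Set) → Set
Disjoint A = ∀ i j → i ≢ j → ∀ x → A i x → ¬ A j x

-- A pairing of natural numbers.

square-pair : ℕ × ℕ → ℕ
square-pair (a , b) = (a ℕ.+ b) ℕ.* (a ℕ.+ b) ℕ.+ a

-- As `a` is at most the sum `s`, the codes of pairs with sum `s` lie between `s * s` and
-- `s * s + s`, below the square of `s + 1`.
square-pair-< : ∀ p q → proj₁ p ℕ.+ proj₂ p ℕ.< proj₁ q ℕ.+ proj₂ q → square-pair p ℕ.< square-pair q
square-pair-< (a , b) (c , d) s<t = begin-strict
  s ℕ.* s ℕ.+ a            ≤⟨ ℕ.+-monoʳ-≤ (s ℕ.* s) (ℕ.m≤m+n a b) ⟩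
  s ℕ.* s ℕ.+ s            ≡⟨ trans (ℕ.+-comm (s ℕ.* s) s) (sym (ℕ.*-suc s s)) ⟩
  s ℕ.* suc s              <⟨ ℕ.m<n+m (s ℕ.* suc s) (s≤s z≤n) ⟩
  suc s ℕ.* suc s          ≤⟨ ℕ.*-mono-≤ s<t s<t ⟩
  t ℕ.* t                  ≤⟨ ℕ.m≤m+n (t ℕ.* t) c ⟩
  t ℕ.* t ℕ.+ c            ∎
  where
  open ℕ.≤-Reasoning
  s = a ℕ.+ b
  t = c ℕ.+ d

square-pair-injective : ∀ {p q} → square-pair p ≡ square-pair q → p ≡ q
square-pair-injective {p@(a , b)} {q@(c , d)} eq with ℕ.<-cmp (a ℕ.+ b) (c ℕ.+ d)
... | tri< s<t _ _ = ⊥-elim (ℕ.<⇒≢ (square-pair-< p q s<t) eq)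
... | tri> _ _ t<s = ⊥-elim (ℕ.<⇒≢ (square-pair-< q p t<s) (sym eq))
... | tri≈ _ s≡t _ = cong₂ _,_ a≡c (ℕ.+-cancelˡ-≡ a b d (trans s≡t (cong (ℕ._+ d) (sym a≡c))))
  where
  a≡c : a ≡ c
  a≡c = ℕ.+-cancelˡ-≡ ((a ℕ.+ b) ℕ.* (a ℕ.+ b)) a c
    (trans eq (cong (λ t → t ℕ.* t ℕ.+ c) (sym s≡t)))

-- Classical logic and power sets.

module ClassicalLogic (em : ExcludedMiddle 0ℓ) (ext : Extensionality 0ℓ 0ℓ) where
  open Classical em

  lem : (A : Set) → A ⊎ ¬ A
  lem A with em {A}
  ... | yes a = inj₁ a
  ... | no ¬a = inj₂ ¬a

  dne : {A : Set} → ¬ ¬ A → A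
  dne {A} ¬¬a with lem A
  ... | inj₁ a  = a
  ... | inj₂ ¬a = ⊥-elim (¬¬a ¬a)

  ¬∀⇒∃¬ : {A : Set} {B : A → Set} → ¬ (∀ x → B x) → ∃[ x ] ¬ B x
  ¬∀⇒∃¬ ¬∀ = dne λ ¬∃ → ¬∀ λ x → dne λ ¬b → ¬∃ (x , ¬b)

  𝒫-ext : {A : Set} {B C : 𝒫 A} → B ⊆ C → C ⊆ B → B ≡ C
  𝒫-ext {A} {B} {C} B⊆C C⊆B = ext λ x → T-ext (B⊆C x) (C⊆B x)
    where
    T-ext : ∀ {b c} → (T b → T c) → (T c → T b) → b ≡ c
    T-ext {true}  {true}  _ _ = refl
    T-ext {true}  {false} f _ = ⊥-elim (f tt)
    T-ext {false} {true}  _ g = ⊥-elim (g tt)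
    T-ext {false} {false} _ _ = refl

  ⟪⟫-cong : {A : Set} {P Q : A → Set} → (∀ x → P x → Q x) → (∀ x → Q x → P x) → ⟪ P ⟫ ≡ ⟪ Q ⟫
  ⟪⟫-cong {P = P} {Q} f g =
    𝒫-ext (λ x → ∈-intro Q ∘ f x ∘ ∈-elim P) (λ x → ∈-intro P ∘ g x ∘ ∈-elim Q)

  El-≡ : {A : Set} {B : 𝒫 A} {u v : El B} → proj₁ u ≡ proj₁ v → u ≡ v
  El-≡ {u = x , p} {_ , q} refl = cong (x ,_) (T-irrelevant p q)

  El-↣ : {A : Set} (B : 𝒫 A) → El B ↣ A
  El-↣ B = mk↣ El-≡

  𝒫-↣ : {A B : Set} → A ↣ B → 𝒫 A ↣ 𝒫 B
  𝒫-↣ {A} {B} A↣B = mk↣ {to = image} λ {C} {D} eq →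
    𝒫-ext (reflects C D eq) (reflects D C (sym eq))
    where
    open Injection A↣B using (to; injective)

    Hit : 𝒫 A → B → Set
    Hit C b = ∃[ a ] (a ∈ C × to a ≡ b)

    image : 𝒫 A → 𝒫 B
    image C = ⟪ Hit C ⟫

    reflects : ∀ C D → image C ≡ image D → C ⊆ D
    reflects C D eq a a∈C
      with ∈-elim (Hit D) (subst (to a ∈_) eq (∈-intro (Hit C) (a , a∈C , refl)))
    ... | b , b∈D , eq′ = subst (_∈ D) (injective eq′) b∈D

  ≡ᵇ-injective : ∀ {m n} → (m ≡ᵇ_) ≡ (n ≡ᵇ_) → m ≡ n
  ≡ᵇ-injective {m} {n} eq =
    sym (ℕ.≡ᵇ⇒≡ n m (subst T (cong (λ f → f m) eq) (ℕ.≡⇒≡ᵇ m m refl)))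

  -- Well-orders and transfinite enumeration.

  module WellOrder {W : Set} {_<_ : Rel W 0ℓ}
    (sto : IsStrictTotalOrder _≡_ _<_) (wf : WellFounded _<_) where
    open IsStrictTotalOrder sto using (compare)

    IsLeast : (W → Set) → W → Set
    IsLeast P w = P w × (∀ v → v < w → ¬ P v)

    least : (P : W → Set) → ∃ P → ∃ (IsLeast P)
    least P (w , p) = dne λ ¬∃ →
      All.wfRec wf 0ℓ (λ v → ¬ P v) (λ v ih q → ¬∃ (v , q , λ u → ih {u})) w p

    least-unique : ∀ {P v w} → IsLeast P v → IsLeast P w → v ≡ w
    least-unique {_} {v} {w} (p , minv) (q , minw) with compare v w
    ... | tri< v<w _ _ = ⊥-elim (minw v v<w p)
    ... | tri≈ _ eq _  = eq
    ... | tri> _ _ w<v = ⊥-elim (minv w w<v q)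

    module _ (S : Set) where
      private
        Fresh : ∀ i → WfRec _<_ (λ _ → Maybe S) i → S → Set
        Fresh i h s = ∀ j (p : j < i) → h {j} p ≢ just s

        pick : ∀ i → WfRec _<_ (λ _ → Maybe S) i → Maybe S
        pick i h with em {∃ (Fresh i h)}
        ... | yes (s , _) = just s
        ... | no _        = nothing

        pick-cong : ∀ i {h h′ : WfRec _<_ (λ _ → Maybe S) i} →
                    (∀ {j} (p : j < i) → h p ≡ h′ p) → pick i h ≡ pick i h′
        -- `h` has an implicit and an explicit argument, so extensionality is used once for each.
        pick-cong i eq = cong (λ h → pick i (λ {j} → h {j})) (implicit-extensionality ext λ {j} → ext (eq {j}))

        e : W → Maybe S
        e = All.wfRec wf 0ℓ (λ _ → Maybe S) pick

        e-unfold : ∀ i → e i ≡ pick i (λ {j} _ → e j)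
        e-unfold i = FixPoint.unfold-wfRec wf (λ _ → Maybe S) pick pick-cong

        e-fresh : ∀ {i s} → e i ≡ just s → ∀ j → j < i → e j ≢ just s
        e-fresh {i} eq with em {∃ (Fresh i (λ {j} _ → e j))} | e-unfold i
        ... | yes (s , fresh) | eq′ = subst (λ s → ∀ j → j < i → e j ≢ just s)
                                        (just-injective (trans (sym eq′) eq)) fresh
        ... | no _            | eq′ with () ← trans (sym eq′) eq

        e-exhausted : ∀ {i} → e i ≡ nothing → ∀ s → ∃[ j ] (j < i × e j ≡ just s)
        e-exhausted {i} eq s with em {∃ (Fresh i (λ {j} _ → e j))} | e-unfold i
        ... | yes _ | eq′ with () ← trans (sym eq′) eq
        ... | no ¬∃ | _   = dne λ ¬hit → ¬∃ (s , λ j j<i eq′ → ¬hit (j , j<i , eq′))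

        e-injective : ∀ {i j s t} → e i ≡ just s → e j ≡ just t → s ≡ t → i ≡ j
        e-injective {i} {j} p q refl with compare i j
        ... | tri< i<j _ _  = ⊥-elim (e-fresh q i i<j p)
        ... | tri≈ _ refl _ = refl
        ... | tri> _ _ j<i  = ⊥-elim (e-fresh p j j<i q)

        value : ∀ {i} → e i ≢ nothing → ∃[ s ] e i ≡ just s
        value {i} defined with e i
        ... | just s  = s , refl
        ... | nothing = ⊥-elim (defined refl)

      -- Elements of S are picked one after the other, avoiding the earlier ones:
      -- either S is exhausted at some stage γ, or W injects into S.
      embeds-or-enumerates : (W ↣ S) ⊎ (∃[ γ ] (El ⟪ (λ i → i < γ) ⟫ ⤖ S))
      embeds-or-enumerates with em {∃[ i ] e i ≡ nothing}
      ... | no ¬∃ = inj₁ (mk↣ λ {i} {j} → e-injective (proj₂ (v i)) (proj₂ (v j)))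
        where
        v : ∀ i → ∃[ s ] e i ≡ just s
        v i = value λ eq → ¬∃ (i , eq)
      -- At the first stage `γ` with nothing left to pick, all earlier stages carry values, and
      -- exhaustion says that these values are all of `S`.
      ... | yes ∃γ with least (λ i → e i ≡ nothing) ∃γ
      ... | γ , stop , defined = inj₂ (γ , mk⤖ (inj , surj))
        where
        v : (i : El ⟪ (λ i → i < γ) ⟫) → ∃[ s ] e (proj₁ i) ≡ just s
        v (i , i∈) = value (defined i (∈-elim (λ i → i < γ) i∈))

        inj : ∀ {i j} → proj₁ (v i) ≡ proj₁ (v j) → i ≡ j
        inj {i} {j} eq = El-≡ (e-injective (proj₂ (v i)) (proj₂ (v j)) eq)

        surj : ∀ s → ∃[ i ] (∀ {j} → j ≡ i → proj₁ (v j) ≡ s)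
        surj s with e-exhausted stop s
        ... | j , j<γ , eq = (j , ∈-intro (λ i → i < γ) j<γ) , λ where
          refl → just-injective (trans (sym (proj₂ (v (j , ∈-intro (λ i → i < γ) j<γ)))) eq)

  -- Cardinals and small index sets.

  open InfiniteCardinal using (Below) renaming (Carrier to ∣_∣)

  module CardinalOrder (ƛ : InfiniteCardinal) where
    open WellOrder (InfiniteCardinal.isStrictTotalOrder ƛ) (InfiniteCardinal.wellFounded ƛ) public

    -- Turns smallness, stated as the absence of an injection, into an indexing by a smaller
    -- ordinal, the form that `𝔐-⋃` and `M4` ask for.
    enumerates : {S : Set} → ¬ (∣ ƛ ∣ ↣ S) → ∃[ γ ] (Below ƛ γ ⤖ S)
    enumerates {S} small with embeds-or-enumerates S
    ... | inj₁ λ↣S = ⊥-elim (small λ↣S)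
    ... | inj₂ enum = enum

  -- Two distinct elements of `κ` are comparable, so the larger one has something below it.
  inhabited-segment : (κ : InfiniteCardinal) → ∃[ γ ] Below κ γ
  inhabited-segment κ = by-order (κ.compare a b)
    where
    module κ = InfiniteCardinal κ
    a = Injection.to κ.infinite 0
    b = Injection.to κ.infinite 1

    by-order : Tri (a κ.< b) (a ≡ b) (b κ.< a) → ∃[ γ ] Below κ γ
    by-order (tri< a<b _ _) = b , a , ∈-intro (λ i → i κ.< b) a<b
    by-order (tri> _ _ b<a) = a , b , ∈-intro (λ i → i κ.< a) b<a
    by-order (tri≈ _ eq _) with () ← Injection.injective κ.infinite eq

  module ℕ-Order = WellOrder ℕ.<-isStrictTotalOrder ℕ.<-wellFounded

  ℕ-small : {ƛ : InfiniteCardinal} → AboveContinuum ƛ → ¬ (∣ ƛ ∣ ↣ ℕ)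
  ℕ-small (_ , ¬λ↣c) λ↣ℕ = ¬λ↣c (mk↣ {to = _≡ᵇ_} ≡ᵇ-injective ↣-∘ λ↣ℕ)

  Bool-small : {ƛ : InfiniteCardinal} → AboveContinuum ƛ → ¬ (∣ ƛ ∣ ↣ Bool)
  Bool-small (_ , ¬λ↣c) λ↣2 = ¬λ↣c (mk↣ {to = λ b _ → b} (cong (λ f → f 0)) ↣-∘ λ↣2)

  -- Big k P stands for "P is measurable of measure greater than 1/(k+1)".  These
  -- are the only properties of μ that the passage to an ultrafilter depends on.
  record Content (ƛ : InfiniteCardinal) (X : Set) : Set₁ where
    field
      Meas       : (X → Set) → Set
      Big        : ℕ → (X → Set) → Set
      mono       : ∀ {k P Q} → Meas Q → (∀ x → P x → Q x) → Big k P → Big k Q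
      weaken     : ∀ {k l P} → k ℕ.≤ l → Big k P → Big l P
      exhaustive : ∀ {k} (A : ℕ → X → Set) → Disjoint A → ¬ (∀ n → Big k (A n))
      meas-⋃     : ∀ {S} → ¬ (∣ ƛ ∣ ↣ S) → (A : S → X → Set) → (∀ s → Meas (A s)) →
                   Meas (λ x → ∃[ s ] A s x)

    Null : (X → Set) → Set
    Null P = ∀ k → ¬ Big k P

    field
      null-⋃ : ∀ {S} → ¬ (∣ ƛ ∣ ↣ S) → (A : S → X → Set) → (∀ s → Meas (A s)) →
               Disjoint A → (∀ s → Null (A s)) → Null (λ x → ∃[ s ] A s x)

    null-mono : ∀ {P Q} → Meas Q → (∀ x → P x → Q x) → Null Q → Null P
    null-mono mQ P⊆Q nQ k = nQ k ∘ mono mQ P⊆Q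

    -- The constant sequence of empty sets is pairwise disjoint, so `exhaustive` forbids its terms
    -- to be big.
    null-empty : ∀ {P} → (∀ x → ¬ P x) → Null P
    null-empty ¬P k big = exhaustive (λ _ → _) (λ _ _ _ x p _ → ¬P x p) (λ _ → big)

    ¬null⇒big : ∀ {P} → ¬ Null P → ∃[ k ] Big k P
    ¬null⇒big ¬null with ¬∀⇒∃¬ ¬null
    ... | k , ¬¬big = k , dne ¬¬big

  module _ {ƛ : InfiniteCardinal} (above : AboveContinuum ƛ) {X : Set} (C : Content ƛ X) where
    open Content C

    null-∪-disjoint : {P Q R : X → Set} → Meas P → Meas Q → (∀ x → P x → ¬ Q x) →
                      (∀ x → R x → P x ⊎ Q x) → Null P → Null Q → Null R
    null-∪-disjoint {P} {Q} mP mQ P∩Q R⊆P∪Q nP nQ =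
      null-mono (meas-⋃ small A mA) (λ x → either x ∘ R⊆P∪Q x)
        (null-⋃ small A mA A-disjoint (λ where
          true  → nP
          false → nQ))
      where
      small = Bool-small {ƛ} above

      A : Bool → X → Set
      A true  = P
      A false = Q

      mA : ∀ b → Meas (A b)
      mA true  = mP
      mA false = mQ

      A-disjoint : Disjoint A
      A-disjoint true  true  b≢c x p q = b≢c refl
      A-disjoint true  false b≢c x p q = P∩Q x p q
      A-disjoint false true  b≢c x q p = P∩Q x p q
      A-disjoint false false b≢c x p q = b≢c refl

      either : ∀ x → P x ⊎ Q x → ∃[ b ] A b x
      either x (inj₁ p) = true , p
      either x (inj₂ q) = false , q

  -- Atoms and ultrafilters

  module AtomExists (ƛ : InfiniteCardinal) (above : AboveContinuum ƛ) {I : Set} (C : Content ƛ I)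
    (total : ∀ P → Content.Meas C P) (nonnull : ¬ Content.Null C (λ _ → ⊤)) where
    open Content C

    IsAtom : 𝒫 I → Set
    IsAtom A = ¬ Null (_∈ A) × ((B : 𝒫 I) → ∃[ b ] Null (λ i → i ∈ A × B i ≡ b))

    private
      Split : ℕ → (I → Set) → 𝒫 I → Set
      Split k P B = ∀ b → Big k (λ i → P i × B i ≡ b)

      Splits : (I → Set) → ℕ → Set
      Splits P k = ∃ (Split k P)

      -- The threshold k is chosen least possible: this stands in for halving the measure.
      split : (I → Set) → 𝒫 I
      split P with em {∃ (Splits P)}
      ... | yes ∃k = proj₁ (proj₁ (proj₂ (ℕ-Order.least (Splits P) ∃k)))
      ... | no _   = λ _ → true

      -- The least threshold `l` at which `P` splits is at most `k`, and a set above 1/(l+1) is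
      -- above 1/(k+1).
      split-splits : ∀ {P k} → Splits P k → Split k P (split P)
      split-splits {P} {k} s b with em {∃ (Splits P)}
      ... | no ¬∃k = ⊥-elim (¬∃k (k , s))
      ... | yes ∃k with ℕ-Order.least (Splits P) ∃k
      ... | l , (B , bigB) , l-least = weaken (ℕ.≮⇒≥ λ k<l → l-least k k<l s) (bigB b)

      part : (I → Set) → Bool → I → Set
      part P b i = P i × split P i ≡ b

      node : (ℕ → Bool) → ℕ → I → Set
      node f zero    = λ _ → ⊤
      node f (suc n) = part (node f n) (f n)

      branch : (ℕ → Bool) → I → Set
      branch f i = ∀ n → node f n i

      node-antitone : ∀ f {m n} → m ℕ.≤′ n → ∀ i → node f n i → node f m i
      node-antitone f ℕ.≤′-refl       i p       = p
      node-antitone f (ℕ.≤′-step m≤n) i (p , _) = node-antitone f m≤n i p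

      -- A common point `i` forces `f n` and `g n` both to be the value at `i` of the splitting of
      -- the current node; by induction the nodes agree as well.
      branch-disjoint : Disjoint branch
      branch-disjoint f g f≢g i i∈f i∈g = f≢g (ext (proj₂ ∘ agree))
        where
        agree : ∀ n → node f n ≡ node g n × f n ≡ g n
        agree zero    = refl , trans (sym (proj₂ (i∈f 1))) (proj₂ (i∈g 1))
        agree (suc n) = eq , trans (sym (proj₂ (i∈f (suc (suc n)))))
                               (trans (cong (λ P → split P i) eq) (proj₂ (i∈g (suc (suc n)))))
          where eq = cong₂ part (proj₁ (agree n)) (proj₂ (agree n))

      branch-cover : ∀ i → ∃[ f ] branch f i
      branch-cover i = f , λ n → subst (λ P → P i) (sym (path≡node n)) (on-path n)
        where
        -- `path` follows `i` directly; reading `f` off `node f` would be circular.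
        path : ℕ → I → Set
        path zero    = λ _ → ⊤
        path (suc n) = part (path n) (split (path n) i)

        f : ℕ → Bool
        f n = split (path n) i

        path≡node : ∀ n → node f n ≡ path n
        path≡node zero    = refl
        path≡node (suc n) = cong (λ P → part P (f n)) (path≡node n)

        on-path : ∀ n → path n i
        on-path zero    = tt
        on-path (suc n) = on-path n , refl

      -- The branches partition `I` and there are only continuum many, which is fewer than `ƛ`; if
      -- all were null, so would `I` be.
      nonnull-branch : ∃[ f ] ¬ Null (branch f)
      nonnull-branch = ¬∀⇒∃¬ λ null → nonnull
        (null-mono (total _) (λ i _ → branch-cover i)
          (null-⋃ (proj₂ above) branch (λ f → total _) branch-disjoint null))

      not-≢ : ∀ b → b ≢ not b
      not-≢ true  ()
      not-≢ false ()

      -- A splitting of the branch also splits each of its nodes, so by minimality of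
      -- the thresholds all pieces removed along the branch are above 1/(k+1).
      branch-unsplittable : ∀ f k → ¬ Splits (branch f) k
      branch-unsplittable f k (B , big) = exhaustive removed removed-disjoint removed-big
        where
        removed : ℕ → I → Set
        removed n = part (node f n) (not (f n))

        removed-big : ∀ n → Big k (removed n)
        removed-big n = split-splits
          (B , λ b → mono (total _) (λ i (i∈f , eq) → i∈f n , eq) (big b)) (not (f n))

        left-behind : ∀ {m n} i → m ℕ.< n → removed m i → ¬ removed n i
        left-behind {m} i m<n (_ , eq) (p , _) =
          not-≢ (f m) (trans (sym (proj₂ (node-antitone f (ℕ.≤⇒≤′ m<n) i p))) eq)

        removed-disjoint : Disjoint removed
        removed-disjoint m n m≢n i p q with ℕ.<-cmp m n
        ... | tri< m<n _ _ = left-behind i m<n p q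
        ... | tri≈ _ eq _  = m≢n eq
        ... | tri> _ _ n<m = left-behind i n<m q p

    atom : ∃ IsAtom
    atom with nonnull-branch
    ... | f , ¬null = A , (λ nullA → ¬null (null-mono (total _) (λ i → ∈-intro (branch f)) nullA)) , halves
      where
      A = ⟪ branch f ⟫

      halves : (B : 𝒫 I) → ∃[ b ] Null (λ i → i ∈ A × B i ≡ b)
      -- If neither half were null, both would be big at the larger of their two thresholds, and `B`
      -- would split the branch.
      halves B = dne λ ¬null-half →
        let big b = ¬null⇒big (λ null → ¬null-half (b , null))
            k = proj₁ (big true) ℕ.⊔ proj₁ (big false)
            k≥ : ∀ b → proj₁ (big b) ℕ.≤ k
            k≥ = λ where
              true  → ℕ.m≤m⊔n _ _
              false → ℕ.m≤n⊔m _ _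
        in branch-unsplittable f k
             (B , λ b → mono (total _) (λ i (i∈A , eq) → ∈-elim (branch f) i∈A , eq)
                          (weaken (k≥ b) (proj₂ (big b))))

  module TotalContent (ƛ : InfiniteCardinal) (above : AboveContinuum ƛ) {I : Set} (C : Content ƛ I)
    (total : ∀ P → Content.Meas C P) (points : ∀ i → Content.Null C (_≡ i))
    (nonnull : ¬ Content.Null C (λ _ → ⊤)) (I↣λ : I ↣ ∣ ƛ ∣) where
    open Content C
    open CardinalOrder ƛ
    open InfiniteCardinal ƛ using (_<_; compare; initial; infinite)

    -- The family is made disjoint by enumerating `S` along an ordinal below `ƛ` and keeping each
    -- point only in the first set that holds it. The pieces are measurable because every set is.
    null-⋃-any : ∀ {S} → ¬ (∣ ƛ ∣ ↣ S) → (A : S → I → Set) → (∀ s → Null (A s)) →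
                 Null (λ i → ∃[ s ] A s i)
    null-⋃-any {S} small A null with enumerates small
    ... | γ , enum = null-mono (total _) first
                       (null-⋃ (initial γ) D (λ _ → total _) D-disjoint
                         (λ j → null-mono (total _) (λ i → proj₁) (null (to j))))
      where
      open Bijection enum using (to; surjective)

      D : Below ƛ γ → I → Set
      D j i = A (to j) i × (∀ k → proj₁ k < proj₁ j → ¬ A (to k) i)

      D-disjoint : Disjoint D
      D-disjoint j k j≢k i (p , p-first) (q , q-first) with compare (proj₁ j) (proj₁ k)
      ... | tri< j<k _ _ = q-first j j<k p
      ... | tri≈ _ eq _  = j≢k (El-≡ eq)
      ... | tri> _ _ k<j = p-first k k<j q

      Hit : I → ∣ ƛ ∣ → Set
      Hit i w = ∃[ j ] (proj₁ j ≡ w × A (to j) i)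

      first : ∀ i → ∃[ s ] A s i → ∃[ j ] D j i
      first i (s , p) with surjective s
      ... | j , eq with least (Hit i) (proj₁ j , j , refl , subst (λ s → A s i) (sym (eq refl)) p)
      ... | w , (k , k≡w , q) , min =
        k , q , λ l l<k r → min (proj₁ l) (subst (proj₁ l <_) k≡w l<k) (l , refl , r)

    null-∪ : {P Q R : I → Set} → (∀ i → R i → P i ⊎ Q i) → Null P → Null Q → Null R
    null-∪ {P} {Q} R⊆P∪Q nP nQ = null-∪-disjoint {ƛ} above C {P} {λ i → Q i × ¬ P i}
      (total _) (total _) (λ i p (_ , ¬p) → ¬p p) (λ i → separate i ∘ R⊆P∪Q i)
      nP (null-mono (total _) (λ i → proj₁) nQ)
      where
      separate : ∀ i → P i ⊎ Q i → P i ⊎ (Q i × ¬ P i)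
      separate i (inj₁ p) = inj₁ p
      separate i (inj₂ q) with lem (P i)
      ... | inj₁ p  = inj₁ p
      ... | inj₂ ¬p = inj₂ (q , ¬p)

    measurable : IsMeasurable ƛ
    measurable with AtomExists.atom ƛ above C total nonnull
    ... | A , A-nonnull , halves = (infinite , ℕ-small {ƛ} above) , 𝒰 , isUltrafilter , nonprincipal , complete
      where
      h = Injection.to I↣λ

      Trace∈ Trace∉ : 𝒫 ∣ ƛ ∣ → I → Set
      Trace∈ B i = i ∈ A × h i ∈ B
      Trace∉ B i = i ∈ A × h i ∉ B

      -- The injection `h` transports the ultrafilter from `I` to `ƛ`. Inside the atom, non-null and
      -- co-null coincide, by `co-null` and `co-null⁻¹`.
      Positive : 𝒫 ∣ ƛ ∣ → Set
      Positive B = ¬ Null (Trace∈ B)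

      𝒰 = ⟪ Positive ⟫

      𝒰-intro : ∀ B → Positive B → B ∈ 𝒰
      𝒰-intro B = ∈-intro Positive {B}

      𝒰-elim : ∀ B → B ∈ 𝒰 → Positive B
      𝒰-elim B = ∈-elim Positive {B}

      T⇒≡true : ∀ {b} → T b → b ≡ true
      T⇒≡true {true} _ = refl

      ¬T⇒≡false : ∀ {b} → ¬ T b → b ≡ false
      ¬T⇒≡false {true}  ¬t = ⊥-elim (¬t tt)
      ¬T⇒≡false {false} _  = refl

      co-null : ∀ B → Positive B → Null (Trace∉ B)
      co-null B pos with halves (B ∘ h)
      ... | true  , null = ⊥-elim (pos (null-mono (total _) (λ i (i∈A , p) → i∈A , T⇒≡true p) null))
      ... | false , null = null-mono (total _) (λ i (i∈A , p) → i∈A , ¬T⇒≡false p) null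

      co-null⁻¹ : ∀ B → Null (Trace∉ B) → Positive B
      co-null⁻¹ B null∉ null∈ = A-nonnull (null-∪ by-cases null∈ null∉)
        where
        by-cases : ∀ i → i ∈ A → Trace∈ B i ⊎ Trace∉ B i
        by-cases i i∈A with lem (h i ∈ B)
        ... | inj₁ p = inj₁ (i∈A , p)
        ... | inj₂ ¬p = inj₂ (i∈A , ¬p)

      -- The complements of the sets `B s` have null traces on `A`, hence so has their union. The
      -- target `B′` is left free to serve binary and indexed intersections alike.
      positive-⋂ : ∀ {S} → ¬ (∣ ƛ ∣ ↣ S) → (B : S → 𝒫 ∣ ƛ ∣) → (∀ s → Positive (B s)) →
                   ∀ B′ → (∀ x → (∀ s → x ∈ B s) → x ∈ B′) → Positive B′
      positive-⋂ small B pos B′ ⋂⊆B′ = co-null⁻¹ B′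
        (null-mono (total _)
          (λ i (i∈A , i∉) → let (s , ¬p) = ¬∀⇒∃¬ (i∉ ∘ ⋂⊆B′ (h i)) in s , i∈A , ¬p)
          (null-⋃-any small (Trace∉ ∘ B) λ s → co-null (B s) (pos s)))

      isUltrafilter : IsUltrafilter 𝒰
      isUltrafilter = record
        { full∈  = 𝒰-intro full λ null → A-nonnull
            (null-mono (total _) (λ i i∈A → i∈A , ∈-intro (λ _ → ⊤) {h i} tt) null)
        ; ∅∉     = λ ∅∈ → 𝒰-elim ∅ ∅∈
            (null-empty λ i (_ , i∈∅) → ∈-elim (λ _ → ⊥) {h i} i∈∅)
        ; upward = λ B B′ B⊆B′ B∈ → 𝒰-intro B′ λ null →
            𝒰-elim B B∈ (null-mono (total _) (λ i (i∈A , p) → i∈A , B⊆B′ (h i) p) null)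
        ; ∩∈     = λ B B′ B∈ B′∈ → 𝒰-intro (B ∩ B′)
            (positive-⋂ (Bool-small {ƛ} above) (pair B B′)
              (λ where
                true  → 𝒰-elim B B∈
                false → 𝒰-elim B′ B′∈)
              (B ∩ B′) λ x x∈ → ∈-intro (λ y → y ∈ B × y ∈ B′) (x∈ true , x∈ false))
        ; ultra  = ultra
        }
        where
        pair : 𝒫 ∣ ƛ ∣ → 𝒫 ∣ ƛ ∣ → Bool → 𝒫 ∣ ƛ ∣
        pair B B′ true  = B
        pair B B′ false = B′

        ultra : ∀ B → B ∈ 𝒰 ⊎ ∁ B ∈ 𝒰
        ultra B with lem (Positive B)
        ... | inj₁ pos = inj₁ (𝒰-intro B pos)
        ... | inj₂ ¬pos = inj₂ (𝒰-intro (∁ B) (co-null⁻¹ (∁ B)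
          (null-mono (total _)
            (λ i (i∈A , ¬p) → i∈A , dne (¬p ∘ ∈-intro (λ x → x ∉ B)))
            (dne ¬pos))))

      nonprincipal : ¬ IsPrincipal 𝒰
      nonprincipal (a , generates) =
        𝒰-elim ｛ a ｝ (Equivalence.from (generates ｛ a ｝) (∈-intro (λ x → x ≡ a) refl)) null
        where
        null : Null (Trace∈ ｛ a ｝)
        -- The preimage of `a` under the injection `h` is a single null point, or empty if `a` is
        -- outside the range.
        null with lem (∃[ i ] h i ≡ a)
        ... | inj₁ (j , hj≡a) = null-mono (total _)
          (λ i (_ , p) → Injection.injective I↣λ (trans (∈-elim (λ x → x ≡ a) p) (sym hj≡a))) (points j)
        ... | inj₂ ¬∃ = null-empty λ i (_ , p) → ¬∃ (i , ∈-elim (λ x → x ≡ a) p)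

      complete : IsComplete ƛ 𝒰
      complete γ B B∈ = 𝒰-intro (⋂ B)
        (positive-⋂ (initial γ) B (λ s → 𝒰-elim (B s) (B∈ s)) (⋂ B)
          λ x → ∈-intro (λ x → ∀ s → x ∈ B s))

  -- Arithmetic of cuts

  open [0,∞]

  -- This is 1/(k+1), since `mkℚ` stores the denominator minus one.
  ε : ℕ → ℚ
  ε k = mkℚ (ℤ.+ 1) k (1-coprimeTo (suc k))

  infixr 8 _⋆_

  _⋆_ : ℕ → ℚ → ℚ
  zero  ⋆ q = 0ℚ
  suc n ⋆ q = q ℚ.+ n ⋆ q

  0<ε : ∀ k → 0ℚ ℚ.< ε k
  0<ε k = ℚ.positive⁻¹ (ε k)

  ε-antitone : ∀ {k l} → k ℕ.≤ l → ε l ℚ.≤ ε k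
  ε-antitone k≤l = ℚ.*≤* (subst₂ ℤ._≤_ (sym (ℤ.*-identityˡ _)) (sym (ℤ.*-identityˡ _)) (ℤ.+≤+ (s≤s k≤l)))

  -- A positive fraction (m+1)/(d+1) is at least 1/(d+1).
  ε-below : ∀ q → 0ℚ ℚ.< q → ∃[ k ] ε k ℚ.≤ q
  ε-below q 0<q with q | ℚ.positive 0<q
  ... | mkℚ (ℤ.+[1+ m ]) d _ | _ = d , ℚ.*≤*
    (subst₂ ℤ._≤_ (sym (ℤ.*-identityˡ _)) (ℤ.pos-* (suc m) (suc d)) (ℤ.+≤+ (ℕ.m≤m+n (suc d) (m ℕ.* suc d))))

  suc-k⋆ε : ∀ k → suc k ⋆ ε k ≡ 1ℚ
  suc-k⋆ε k = ℚ.toℚᵘ-injective (ℚᵘ.≃-trans (n⋆ε (suc k)) (ℚᵘ.*≡* (ℤ.*-comm (ℤ.+ suc k) (ℤ.+ 1))))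
    where
    same-denominator : ∀ n d → (ℤ.+ 1 ℤ.* d ℤ.+ n ℤ.* d) ℤ.* d ≡ (ℤ.+ 1 ℤ.+ n) ℤ.* (d ℤ.* d)
    same-denominator = solve-∀

    -- Unnormalised rationals keep the denominator k+1, so no common factors have to be cancelled.
    n⋆ε : ∀ n → ℚ.toℚᵘ (n ⋆ ε k) ℚᵘ.≃ ℚᵘ.mkℚᵘ (ℤ.+ n) k
    n⋆ε zero    = ℚᵘ.*≡* refl
    n⋆ε (suc n) = ℚᵘ.≃-trans (ℚ.toℚᵘ-homo-+ (ε k) (n ⋆ ε k))
      (ℚᵘ.≃-trans (ℚᵘ.+-congʳ (ℚ.toℚᵘ (ε k)) (n⋆ε n))
        (ℚᵘ.*≡* (same-denominator (ℤ.+ n) (ℤ.+ suc k))))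

  -- Already k+1 copies of 1/(k+1) make exactly 1; this takes one more.
  1<⋆ε : ∀ k → 1ℚ ℚ.< suc (suc k) ⋆ ε k
  1<⋆ε k = subst₂ ℚ._<_ (ℚ.+-identityˡ 1ℚ) (cong (ε k ℚ.+_) (sym (suc-k⋆ε k)))
             (ℚ.+-monoˡ-< 1ℚ (0<ε k))

  p+[q-p]≡q : ∀ p q → p ℚ.+ (q ℚ.- p) ≡ q
  p+[q-p]≡q p q = trans (ℚ.+-comm p (q ℚ.- p)) (//-rightDividesˡ p q)

  ≤-trans : ∀ {x y z} → x ≤ y → y ≤ z → x ≤ z
  ≤-trans x≤y y≤z q = y≤z q ∘ x≤y q

  cut-downward : ∀ x {p q} → p ℚ.≤ q → q ∈ cut x → p ∈ cut x
  cut-downward x {p} {q} p≤q q∈ with p ℚ.<? q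
  ... | yes p<q = downward x p<q q∈
  ... | no p≮q  = subst (_∈ cut x) (ℚ.≤-antisym (ℚ.≮⇒≥ p≮q) p≤q) q∈

  -- A cut with a non-negative element `q` also has a larger, hence positive, element `r`, and below
  -- `r` lies some `ε k`.
  null-intro : ∀ x → (∀ k → ε k ∉ cut x) → x ≤ 𝟘
  null-intro x ε∉ q q∈ with q ℚ.<? 0ℚ
  ... | yes q<0 = ∈-intro (ℚ._< 0ℚ) q<0
  ... | no q≮0 with rounded x q∈
  ... | r , q<r , r∈ with ε-below r (ℚ.≤-<-trans (ℚ.≮⇒≥ q≮0) q<r)
  ... | k , ε≤r = ⊥-elim (ε∉ k (cut-downward x ε≤r r∈))

  null-elim : ∀ x → x ≤ 𝟘 → ∀ k → ε k ∉ cut x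
  null-elim x x≤0 k ε∈ = ℚ.<-asym (∈-elim (ℚ._< 0ℚ) (x≤0 (ε k) ε∈)) (0<ε k)

  module _ (x y : [0,∞]) where
    private
      Sum : ℚ → Set
      Sum q = ∃[ a ] ∃[ b ] (a ∈ cut x × b ∈ cut y × q ≡ a ℚ.+ b)

    +-intro : ∀ {a b} → a ∈ cut x → b ∈ cut y → a ℚ.+ b ∈ cut (x + y)
    +-intro a∈ b∈ = ∈-intro Sum (_ , _ , a∈ , b∈ , refl)

    +-elim : ∀ {q} → q ∈ cut (x + y) → Sum q
    +-elim = ∈-elim Sum

    +-nullʳ : y ≤ 𝟘 → x + y ≤ x
    +-nullʳ y≤0 q q∈ with +-elim q∈
    ... | a , b , a∈ , b∈ , refl = downward x
      (subst (a ℚ.+ b ℚ.<_) (ℚ.+-identityʳ a) (ℚ.+-monoʳ-< a (∈-elim (ℚ._< 0ℚ) (y≤0 b b∈)))) a∈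

    +-nullˡ : x ≤ 𝟘 → x + y ≤ y
    +-nullˡ x≤0 q q∈ with +-elim q∈
    ... | a , b , a∈ , b∈ , refl = downward y
      (subst (a ℚ.+ b ℚ.<_) (ℚ.+-identityˡ b) (ℚ.+-monoˡ-< b (∈-elim (ℚ._< 0ℚ) (x≤0 a a∈)))) b∈

  -- Roundedness gives some `r` above `q` in the cut; then `q` is the sum of `r` and the negative
  -- number `q - r`, which lies in the cut of `𝟘`.
  ≤-+𝟘 : ∀ x → x ≤ x + 𝟘
  ≤-+𝟘 x q q∈ with rounded x q∈
  ... | r , q<r , r∈ = subst (_∈ cut (x + 𝟘)) (p+[q-p]≡q r q)
    (+-intro x 𝟘 r∈ (∈-intro (ℚ._< 0ℚ)
      (subst (q ℚ.- r ℚ.<_) (ℚ.+-inverseʳ r) (ℚ.+-monoˡ-< (ℚ.- r) q<r))))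

  module _ {I : Set} (x : I → [0,∞]) where
    total : List I → [0,∞]
    total is = foldr _+_ 𝟘 (map x is)

    private
      UnderPartialSum : ℚ → Set
      UnderPartialSum q = q ℚ.< 0ℚ ⊎ (∃[ is ] q ∈ cut (total (proj₁ {B = Unique} is)))

    total≤∑ : ∀ is → Unique is → total is ≤ ∑ x
    total≤∑ is unique q q∈ = ∈-intro UnderPartialSum (inj₂ ((is , unique) , q∈))

    ∑≤ : ∀ z → (∀ is → Unique is → total is ≤ z) → ∑ x ≤ z
    ∑≤ z bound q q∈ with ∈-elim UnderPartialSum q∈
    ... | inj₁ q<0 = negative z q<0
    ... | inj₂ ((is , unique) , q∈) = bound is unique q q∈

    total-null : ∀ {is} → All (λ i → x i ≤ 𝟘) is → total is ≤ 𝟘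
    total-null []                       = λ _ → id
    total-null {i ∷ is} (xi≤0 ∷ xis≤0) =
      ≤-trans {total (i ∷ is)} {total is} {𝟘} (+-nullˡ (x i) (total is) xi≤0) (total-null xis≤0)

    ∑-null : (∀ i → x i ≤ 𝟘) → ∑ x ≤ 𝟘
    ∑-null null = ∑≤ 𝟘 λ is _ → total-null (All.universal null is)

    total-lower : ∀ {e} → (∀ i → e ∈ cut (x i)) → ∀ is {q} → q ℚ.< length is ⋆ e → q ∈ cut (total is)
    total-lower e∈ []       q<0 = ∈-intro (ℚ._< 0ℚ) q<0
    total-lower {e} e∈ (i ∷ is) {q} q< = subst (_∈ cut (total (i ∷ is))) (p+[q-p]≡q e q)
      (+-intro (x i) (total is) (e∈ i) (total-lower e∈ is
        (subst (q ℚ.- e ℚ.<_) (xyx⁻¹≈y e (length is ⋆ e)) (ℚ.+-monoˡ-< (ℚ.- e) q<))))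

    -- A duplicate-free list contains `i` at most once, and all other entries contribute nothing.
    total-single : ∀ z i → x i ≤ z → (∀ j → j ≢ i → x j ≤ 𝟘) → ∀ is → Unique is → total is ≤ z
    total-single z i xi≤z others [] _ q q∈ = negative z (∈-elim (ℚ._< 0ℚ) q∈)
    total-single z i xi≤z others (j ∷ js) (j∉js ∷ unique) with lem (j ≡ i)
    ... | inj₁ refl = ≤-trans {total (i ∷ js)} {x i} {z}
      (+-nullʳ (x i) (total js) (total-null (All.map (λ {k} i≢k → others k (i≢k ∘ sym)) j∉js))) xi≤z
    ... | inj₂ j≢i = ≤-trans {total (j ∷ js)} {total js} {z}
      (+-nullˡ (x j) (total js) (others j j≢i)) (total-single z i xi≤z others js unique)

    private
      UnderLowerBound : ℚ → Set
      UnderLowerBound q = q ℚ.< 0ℚ ⊎ (Σ[ v ∈ (Σ[ v ∈ [0,∞] ] (∀ i → v ≤ x i)) ] q ∈ cut (proj₁ v))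

    ⨅≤ : ∀ i → ⨅ x ≤ x i
    ⨅≤ i q q∈ with ∈-elim UnderLowerBound q∈
    ... | inj₁ q<0 = negative (x i) q<0
    ... | inj₂ ((v , v≤x) , q∈v) = v≤x i q q∈v

  𝟘≤ : ∀ x → 𝟘 ≤ x
  𝟘≤ x q q∈ = negative x (∈-elim (ℚ._< 0ℚ) q∈)

  𝟙≰𝟘 : ¬ (𝟙 ≤ 𝟘)
  𝟙≰𝟘 1≤0 = ℚ.<-irrefl refl (∈-elim (ℚ._< 0ℚ) (1≤0 0ℚ (∈-intro (ℚ._< 1ℚ) (ℚ.positive⁻¹ 1ℚ))))

  -- Weak measure spaces as contents.

  module MeasureContent {ƛ : InfiniteCardinal} (above : AboveContinuum ƛ) {X : Set} {τ : Topology X}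
    {𝔐 dom : 𝒫 (𝒫 X)} {μ : (A : 𝒫 X) → A ∈ dom → [0,1]} (space : IsWeakMeasureSpace ƛ τ 𝔐 dom μ) where
    open IsWeakMeasureSpace space
    open CardinalOrder ƛ

    Meas : (X → Set) → Set
    Meas P = ⟪ P ⟫ ∈ 𝔐

    -- Measurability is part of bigness, so a non-measurable predicate counts as `Null`. This is why
    -- lemmas on null sets carry separate `Meas` premises.
    Big : ℕ → (X → Set) → Set
    Big k P = Σ[ m ∈ Meas P ] ε k ∈ cut (measure ⟪ P ⟫ m)

    ⟪⟫-mono : {P Q : X → Set} → (∀ x → P x → Q x) → ⟪ P ⟫ ⊆ ⟪ Q ⟫
    ⟪⟫-mono {P} {Q} P⊆Q x = ∈-intro Q ∘ P⊆Q x ∘ ∈-elim P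

    mono : ∀ {k} {P Q : X → Set} → Meas Q → (∀ x → P x → Q x) → Big k P → Big k Q
    mono {k} {P} {Q} mQ P⊆Q (mP , big) = mQ , M3 ⟪ P ⟫ ⟪ Q ⟫ mP mQ (⟪⟫-mono P⊆Q) (ε k) big

    module _ {S : Set} (small : ¬ (∣ ƛ ∣ ↣ S)) (A : S → X → Set) (mA : ∀ s → Meas (A s)) where
      private
        γ = proj₁ (enumerates small)
        open Bijection (proj₂ (enumerates small)) using (to; surjective) renaming (injective to to-injective)

        index : ∀ s → ∃[ i ] to i ≡ s
        index s = let (i , eq) = surjective s in i , eq refl

        A′ : Below ƛ γ → 𝒫 X
        A′ i = ⟪ A (to i) ⟫

        Union : X → Set
        Union x = ∃[ i ] x ∈ A′ i

        A⊆Union : ∀ x → ∃[ s ] A s x → Union x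
        A⊆Union x (s , p) with index s
        ... | i , refl = i , ∈-intro (A (to i)) p

        Union⊆A : ∀ x → Union x → ∃[ s ] A s x
        Union⊆A x (i , x∈) = to i , ∈-elim (A (to i)) x∈

      meas-⋃ : Meas (λ x → ∃[ s ] A s x)
      meas-⋃ = subst (_∈ 𝔐) (⟪⟫-cong Union⊆A A⊆Union) (𝔐-⋃ γ A′ (λ i → mA (to i)))

      module _ (disjoint : Disjoint A) where
        private
          x : Below ƛ γ → [0,∞]
          x i = measure (A′ i) (mA (to i))

          additive : measure ⟪ Union ⟫ (𝔐-⋃ γ A′ (λ i → mA (to i))) ≈ ∑ x
          additive = M4 γ A′ (λ i → mA (to i)) λ i j i≢j y (p , q) →
            disjoint (to i) (to j) (i≢j ∘ to-injective) y (∈-elim (A (to i)) p) (∈-elim (A (to j)) q)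

        null-⋃ : (∀ s k → ¬ Big k (A s)) → ∀ k → ¬ Big k (λ x → ∃[ s ] A s x)
        null-⋃ null k big = null-elim (∑ x) ∑≤0 k (proj₁ additive (ε k) (proj₂ big′))
          where
          big′ : Big k Union
          big′ = mono (𝔐-⋃ γ A′ (λ i → mA (to i))) A⊆Union big

          ∑≤0 : ∑ x ≤ 𝟘
          ∑≤0 = ∑-null x λ i → null-intro (x i) λ l e → null (to i) l (mA (to i) , e)

        -- By additivity, `n` distinct pieces above 1/(k+1) would push the measure of the union
        -- above 1, but `μ` takes values in [0,1].
        many-big : ∀ {k} n (s : ℕ → S) → (∀ {a b} → s a ≡ s b → a ≡ b) → (∀ t → Big k (A t)) →
                   ¬ (1ℚ ℚ.< n ⋆ ε k)
        many-big {k} n s s-injective big 1< =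
          ℚ.<-irrefl refl (∈-elim (ℚ._< 1ℚ) (proj₂ (μ ⟪ Union ⟫ (𝔐⊆dom ⟪ Union ⟫ m)) 1ℚ
            (proj₂ additive 1ℚ (total≤∑ x is is-unique 1ℚ
              (total-lower x big′ is (subst (λ l → 1ℚ ℚ.< l ⋆ ε k) (sym length-is) 1<))))))
          where
          m = 𝔐-⋃ γ A′ (λ i → mA (to i))

          at : ℕ → Below ƛ γ
          at a = proj₁ (index (s a))

          is = map at (upTo n)

          is-unique : Unique is
          is-unique = map⁺ (λ {a} {b} eq → s-injective
            (trans (sym (proj₂ (index (s a)))) (trans (cong to eq) (proj₂ (index (s b)))))) (upTo⁺ n)

          length-is : length is ≡ n
          length-is = trans (length-map at (upTo n)) (length-upTo n)

          big′ : ∀ i → ε k ∈ cut (x i)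
          big′ i = subst (λ m → ε k ∈ cut (measure (A′ i) m)) (T-irrelevant _ _) (proj₂ (big (to i)))

    content : Content ƛ X
    content = record
      { Meas       = Meas
      ; Big        = Big
      ; mono       = mono
      ; weaken     = λ {k} {l} {P} k≤l (m , big) → m , cut-downward (measure ⟪ P ⟫ m) (ε-antitone k≤l) big
      -- The first k+2 sets are already too many; the index set `ℕ` is small because `ƛ` exceeds the
      -- continuum.
      ; exhaustive = λ {k} A disjoint big →
          many-big (ℕ-small {ƛ} above) A (λ n → proj₁ (big n)) disjoint (suc (suc k)) id id big (1<⋆ε k)
      ; meas-⋃     = meas-⋃
      ; null-⋃     = null-⋃
      }

    open Content content public using (Null)

    nonnull : ¬ Null (λ _ → ⊤)
    nonnull null = M2 (null-intro (measure full m) λ k e → null k (m , e))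
      where m = open⊆𝔐 full (Topology.open-X τ)

  -- Contents induced on index sets.

  module _ (ƛ : InfiniteCardinal) (above : AboveContinuum ƛ) {X I : Set} (C : Content ƛ X)
    (U : I → X → Set) (U-disjoint : Disjoint U) where
    open Content C

    private
      Over : (I → Set) → X → Set
      Over J x = ∃[ i ] (J i × U i x)

      over-disjoint : {K : Set} {A : K → I → Set} → Disjoint A → Disjoint (Over ∘ A)
      over-disjoint {A = A} disjoint k l k≢l x (i , p , i∋x) (j , q , j∋x) with lem (i ≡ j)
      ... | inj₁ refl = disjoint k l k≢l i p q
      ... | inj₂ i≢j  = U-disjoint i j i≢j x i∋x j∋x

    module _ (meas-U : ∀ i → Meas (U i)) (meas : ∀ J → Meas (Over J)) where
      private
        -- A set of indices gets the measure of the union of its pieces. Every set of indices counts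
        -- as measurable, because `meas` covers all such unions.
        indexContent : Content ƛ I
        indexContent = record
          { Meas       = λ _ → ⊤
          ; Big        = λ k J → Big k (Over J)
          ; mono       = λ {_} {_} {Q} _ P⊆Q → mono (meas Q) λ x (i , p , i∋x) → i , P⊆Q i p , i∋x
          ; weaken     = weaken
          ; meas-⋃     = λ _ _ _ → tt
          ; exhaustive = λ A disjoint → exhaustive (Over ∘ A) (over-disjoint disjoint)
          ; null-⋃     = λ small A _ disjoint null k →
              null-⋃ small (Over ∘ A) (λ s → meas (A s)) (over-disjoint disjoint) null k
              ∘ mono (meas-⋃ small (Over ∘ A) (λ s → meas (A s))) (λ x (i , (s , p) , i∋x) → s , i , p , i∋x)
          }

      disjoint-null⇒measurable : (∀ i → Null (U i)) → ¬ Null (λ x → ∃[ i ] U i x) → I ↣ ∣ ƛ ∣ → IsMeasurable ƛ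
      disjoint-null⇒measurable null nonnull I↣λ = TotalContent.measurable ƛ above indexContent (λ _ → tt)
        (λ i → null-mono (meas-U i) (λ where x (_ , refl , i∋x) → i∋x) (null i))
        (λ null-all → nonnull (null-mono (meas _) (λ x (i , i∋x) → i , tt , i∋x) null-all))
        I↣λ

  -- The bounded topology

  module Cones (κ ƛ : InfiniteCardinal) (X : 𝒫 (Seq κ ƛ)) where
    private
      module κ = InfiniteCardinal κ
      τ = space κ ƛ X
    open CardinalOrder κ

    -- A cone of `X` is named by a level and one of its points instead of an initial segment; any
    -- other point of the cone serves equally well as centre.
    N : El X → ∣ κ ∣ → El X → Set
    N x α y = ∀ i → i κ.< α → proj₁ x i ≡ proj₁ y i

    N-refl : ∀ x α → N x α x
    N-refl x α i _ = refl

    N-sym : ∀ x y α → N x α y → N y α x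
    N-sym x y α p i i<α = sym (p i i<α)

    N-trans : ∀ x y z α → N x α y → N y α z → N x α z
    N-trans x y z α p q i i<α = trans (p i i<α) (q i i<α)

    N-antitone : ∀ x y {α β} → β κ.< α → N x α y → N x β y
    N-antitone x y β<α p i i<β = p i (κ.<-trans i<β β<α)

    IsOpen : (El X → Set) → Set
    IsOpen P = ∀ x → P x → ∃[ α ] (∀ y → N x α y → P y)

    private
      InCone : <Seq κ ƛ → Seq κ ƛ → Set
      InCone = _⊏_ κ ƛ

      restrict : Seq κ ƛ → ∣ κ ∣ → <Seq κ ƛ
      restrict z α = α , z ∘ proj₁

      TraceOf : 𝒫 (El X) → Set
      TraceOf V = ∃[ U ] (U ∈ Topology.opens (boundedTopology κ ƛ) × Trace X U V)

    open-intro : ∀ {P} → IsOpen P → ⟪ P ⟫ ∈ Topology.opens τ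
    open-intro {P} P-open = ∈-intro TraceOf (⟪ Hull ⟫ , ∈-intro (UnionOf (cone κ ƛ)) hull-open , λ x → mk⇔
        (λ x∈ → ∈-intro P (hull⊆ x (∈-elim Hull x∈)))
        (λ x∈ → ∈-intro Hull (⊆hull x (∈-elim P x∈))))
      where
      -- The ambient open set is the union of all cones around points of `X` whose trace on `X` lies
      -- in `P`.
      Hull : Seq κ ƛ → Set
      Hull z = ∃[ x ] ∃[ α ] ((∀ y → N x α y → P y) × (∀ i → i κ.< α → proj₁ x i ≡ z i))

      hull⊆ : ∀ x → Hull (proj₁ x) → P x
      hull⊆ y (x , α , N⊆P , p) = N⊆P y p

      ⊆hull : ∀ x → P x → Hull (proj₁ x)
      ⊆hull x p = let (α , N⊆P) = P-open x p in x , α , N⊆P , λ _ _ → refl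

      hull-open : UnionOf (cone κ ƛ) ⟪ Hull ⟫
      hull-open z z∈ with ∈-elim Hull z∈
      ... | x , α , N⊆P , p = restrict z α , ∈-intro (InCone (restrict z α)) (λ _ → refl) , λ y y∈ →
        ∈-intro Hull (x , α , N⊆P , λ i i<α → trans (p i i<α)
          (∈-elim (InCone (restrict z α)) y∈ (i , ∈-intro (λ i → i κ.< α) i<α)))

    open-elim : ∀ U → U ∈ Topology.opens τ → IsOpen (_∈ U)
    open-elim U U∈ x x∈U with ∈-elim TraceOf {U} U∈
    ... | V , V∈ , trace with ∈-elim (UnionOf (cone κ ƛ)) V∈ (proj₁ x) (Equivalence.from (trace x) x∈U)
    ... | (α , s) , x∈s , s⊆V = α , λ y p → Equivalence.to (trace y) (s⊆V (proj₁ y)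
      (∈-intro (InCone (α , s)) λ (i , i<α) →
        trans (∈-elim (InCone (α , s)) x∈s (i , i<α)) (p i (∈-elim (λ i → i κ.< α) i<α))))

    -- Q x α is to be read as a property of the set N x α; the cells are the maximal
    -- cones with this property.
    module MaximalCones (Q : El X → ∣ κ ∣ → Set) (Q-cone : ∀ {x y α} → N x α y → Q x α → Q y α) where

      IsCell : 𝒫 (El X) → Set
      IsCell B = ∃[ x ] ∃[ α ] (IsLeast (Q x) α × B ≡ ⟪ N x α ⟫)

      Cell : Set
      Cell = El ⟪ IsCell ⟫

      _∋_ : Cell → El X → Set
      B ∋ x = x ∈ proj₁ B

      private
        -- At levels below `α` the cones around `x` and `y` coincide, so `Q` holds at the same ones.
        least-transport : ∀ x y {α} → N x α y → IsLeast (Q x) α → IsLeast (Q y) α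
        least-transport x y {α} p (q , min) = Q-cone p q , λ β β<α q′ →
          min β β<α (Q-cone (N-sym x y β (N-antitone x y β<α p)) q′)

        around : ∀ y B → B ∋ y → ∃[ α ] (IsLeast (Q y) α × proj₁ B ≡ ⟪ N y α ⟫)
        around y (B , B∈) y∈B with ∈-elim IsCell B∈
        ... | x , α , least-α , refl = α , least-transport x y x~y least-α , ⟪⟫-cong
            (λ z → N-trans y x z α (N-sym x y α x~y)) (λ z → N-trans x y z α x~y)
          where x~y = ∈-elim (N x α) {y} y∈B

      cell-unique : ∀ B C y → B ∋ y → C ∋ y → B ≡ C
      cell-unique B C y y∈B y∈C with around y B y∈B | around y C y∈C
      ... | α , least-α , B≡ | β , least-β , C≡ = El-≡ (trans B≡ (trans
        (cong (λ α → ⟪ N y α ⟫) (least-unique {Q y} least-α least-β)) (sym C≡)))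

      cell-disjoint : Disjoint _∋_
      cell-disjoint B C B≢C y y∈B y∈C = B≢C (cell-unique B C y y∈B y∈C)

      cell-Q : ∀ B → ∃[ x ] ∃[ α ] (Q x α × proj₁ B ≡ ⟪ N x α ⟫)
      cell-Q (B , B∈) with ∈-elim IsCell B∈
      ... | x , α , (q , _) , B≡ = x , α , q , B≡

      centre : ∀ B → ∃[ x ] B ∋ x
      centre B = let (x , α , _ , B≡) = cell-Q B in
        x , subst (x ∈_) (sym B≡) (∈-intro (N x α) {x} (N-refl x α))

      cell-exists : ∀ {x α} → Q x α → ∃[ B ] B ∋ x
      cell-exists {x} {α} q with least (Q x) (α , q)
      ... | β , least-β = (⟪ N x β ⟫ , ∈-intro IsCell (x , β , least-β , refl)) ,
                          ∈-intro (N x β) {x} (N-refl x β)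

      cell-open : ∀ B → IsOpen (B ∋_)
      cell-open B y y∈B = let (α , _ , B≡) = around y B y∈B in
        α , λ z p → subst (z ∈_) (sym B≡) (∈-intro (N y α) {z} p)

      cell∈opens : ∀ B → proj₁ B ∈ Topology.opens τ
      cell∈opens B = subst (_∈ Topology.opens τ)
        (𝒫-ext (λ x → ∈-elim (B ∋_) {x}) (λ x → ∈-intro (B ∋_) {x})) (open-intro (cell-open B))

      -- Each cell contains a member of the base around its centre, and disjointness of the cells
      -- makes these members distinct.
      cells-≤-weight : HasWeight τ ƛ → Cell ↣ ∣ ƛ ∣
      cells-≤-weight ((ℬ , (_ , base) , enum) , _) = mk↣ {to = code} code-injective
        where
        open Bijection enum using (to; surjective)

        inside : ∀ B → ∃[ W ] (proj₁ (centre B) ∈ proj₁ W × proj₁ W ⊆ proj₁ B)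
        inside B = base (proj₁ B) (cell∈opens B) (proj₁ (centre B)) (proj₂ (centre B))

        code : Cell → ∣ ƛ ∣
        code B = proj₁ (surjective (proj₁ (inside B)))

        to-code : ∀ B → to (code B) ≡ proj₁ (inside B)
        to-code B = proj₂ (surjective (proj₁ (inside B))) refl

        code-injective : ∀ {B C} → code B ≡ code C → B ≡ C
        code-injective {B} {C} eq with inside B | inside C | trans (sym (to-code B)) (trans (cong to eq) (to-code C))
        ... | W , x∈W , W⊆B | _ , _ , W⊆C | refl = cell-unique B C _ (W⊆B _ x∈W) (W⊆C _ x∈W)

  -- From a measure to an ultrafilter

  module MeasurableFromSpace (κ ƛ : InfiniteCardinal) (κ≤ƛ : κ ≤ᶜ ƛ) (regular : IsRegular κ)
    (above : AboveContinuum ƛ) (X : 𝒫 (Seq κ ƛ)) (weight : HasWeight (space κ ƛ X) ƛ)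
    (C : Content ƛ (El X)) (meas-open : ∀ {P} → Cones.IsOpen κ ƛ X P → Content.Meas C P)
    (meas-point : ∀ x → Content.Meas C (_≡ x)) (null-point : ∀ x → Content.Null C (_≡ x))
    (nonnull : ¬ Content.Null C (λ _ → ⊤)) where
    private module κ = InfiniteCardinal κ
    open Content C
    open Cones κ ƛ X

    meas-N : ∀ x α → Meas (N x α)
    meas-N x α = meas-open λ y p → α , λ z → N-trans x y z α p

    open MaximalCones (λ x α → Null (N x α))
      (λ {x} {y} {α} p → null-mono (meas-N x α) (λ z → N-trans x y z α p))

    -- Every null cone lies in a maximal one, so this is the union of all null cones.
    Negligible : El X → Set
    Negligible x = ∃[ B ] B ∋ x

    meas-cells : (J : Cell → Set) → Meas (λ x → ∃[ B ] (J B × B ∋ x))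
    meas-cells J = meas-open λ x (B , j , x∈B) →
      let (α , N⊆B) = cell-open B x x∈B in α , λ y p → B , j , N⊆B y p

    meas-negligible : Meas Negligible
    meas-negligible = meas-open λ x (B , x∈B) →
      let (α , N⊆B) = cell-open B x x∈B in α , λ y p → B , N⊆B y p

    measurable-from-cells : ¬ Null Negligible → IsMeasurable ƛ
    measurable-from-cells nonnull = disjoint-null⇒measurable ƛ above C _∋_ cell-disjoint
      (meas-open ∘ cell-open) meas-cells
      (λ B → let (x , α , null , B≡) = cell-Q B in
        null-mono (meas-N x α) (λ y y∈B → ∈-elim (N x α) {y} (subst (y ∈_) B≡ y∈B)) null)
      nonnull (cells-≤-weight weight)

    ¬negligible⇒nonnull : ∀ {x} → ¬ Negligible x → ∀ α → ¬ Null (N x α)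
    ¬negligible⇒nonnull ¬neg α null = ¬neg (cell-exists null)

    -- Regularity is applied to a constant function on a non-empty segment.
    κ-unbounded : ∀ α → ∃[ β ] α κ.< β
    κ-unbounded α = let (γ , i)   = inhabited-segment κ
                        (β , α<β) = regular γ (λ _ → α)
                    in β , α<β i

    upper-bound : ∀ α β → ∃[ γ ] (α κ.< γ × β κ.< γ)
    upper-bound α β with κ.compare α β
    ... | tri< α<β _ _ = let (γ , β<γ) = κ-unbounded β in γ , κ.<-trans α<β β<γ , β<γ
    ... | tri≈ _ refl _ = let (γ , β<γ) = κ-unbounded β in γ , β<γ , β<γ
    ... | tri> _ _ β<α = let (γ , α<γ) = κ-unbounded α in γ , α<γ , κ.<-trans β<α α<γ

    module UncountableHeight (uncountable : ¬ (∣ κ ∣ ↣ ℕ)) (x : El X) (¬negligible : ¬ Negligible x) where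

      -- As `κ` does not embed in `ℕ`, the naturals are enumerated by an ordinal below `κ`, and
      -- regularity applies.
      ℕ-bounded : (f : ℕ → ∣ κ ∣) → ∃[ β ] (∀ n → f n κ.< β)
      ℕ-bounded f with CardinalOrder.enumerates κ uncountable
      ... | γ , enum with regular γ (f ∘ Bijection.to enum)
      ... | β , f<β = β , λ n → let (i , eq) = Bijection.surjective enum n in
        subst (λ m → f m κ.< β) (eq refl) (f<β i)

      Diff : ∣ κ ∣ → ∣ κ ∣ → El X → Set
      Diff α β y = N x α y × ¬ N x β y

      meas-Diff : ∀ {α β} → α κ.< β → Meas (Diff α β)
      meas-Diff {α} {β} α<β = meas-open λ y (p , ¬q) → β , λ z r →
        N-trans x y z α p (N-antitone y z α<β r) , λ q → ¬q (N-trans x z y β q (N-sym y z β r))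

      -- Otherwise an increasing sequence of levels could be chosen with all rings between
      -- consecutive cones big, and these rings are disjoint.
      small-differences : ∀ k → ∃[ α ] (∀ β → α κ.< β → ¬ Big k (Diff α β))
      small-differences k = dne λ ¬∃ → impossible λ α →
        let (β , ¬¬) = ¬∀⇒∃¬ (λ h → ¬∃ (α , h)) in
        β , dne (λ ¬< → ¬¬ λ α<β → ⊥-elim (¬< α<β)) , dne λ ¬big → ¬¬ λ _ → ¬big
        where
        impossible : ¬ (∀ α → ∃[ β ] (α κ.< β × Big k (Diff α β)))
        impossible next = exhaustive ring ring-disjoint λ n → proj₂ (proj₂ (next (a n)))
          where
          a : ℕ → ∣ κ ∣
          a zero    = Injection.to κ.infinite 0
          a (suc n) = proj₁ (next (a n))

          ring : ℕ → El X → Set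
          ring n = Diff (a n) (a (suc n))

          inner : ∀ {m n} → m ℕ.≤′ n → ∀ y → N x (a n) y → N x (a m) y
          inner ℕ.≤′-refl       y p = p
          inner {n = suc n} (ℕ.≤′-step m≤n) y p =
            inner m≤n y (N-antitone x y (proj₁ (proj₂ (next (a n)))) p)

          ring-disjoint : Disjoint ring
          ring-disjoint m n m≢n y (p , ¬p′) (q , ¬q′) with ℕ.<-cmp m n
          ... | tri< m<n _ _ = ¬p′ (inner (ℕ.≤⇒≤′ m<n) y q)
          ... | tri≈ _ eq _  = m≢n eq
          ... | tri> _ _ n<m = ¬q′ (inner (ℕ.≤⇒≤′ n<m) y p)

      -- A level above those for all thresholds `k` works for every `k` at once, since `Diff α β`
      -- shrinks as `α` grows.
      null-differences : ∃[ α ] (∀ β → α κ.< β → Null (Diff α β))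
      null-differences =
        let (α , α>) = ℕ-bounded (proj₁ ∘ small-differences) in
        α , λ β α<β k big →
          let αₖ<β = κ.<-trans (α> k) α<β in
          proj₂ (small-differences k) β αₖ<β
            (mono (meas-Diff αₖ<β) (λ y (p , ¬q) → N-antitone x y (α> k) p , ¬q) big)

      -- From level α on, the cones around x lose only null sets, so the points of
      -- N x α other than x are spread over null sets D β, with β < κ.
      spread⇒measurable : ∀ α → (∀ β → α κ.< β → Null (Diff α β)) → IsMeasurable ƛ
      spread⇒measurable α null = disjoint-null⇒measurable ƛ above C D D-disjoint meas-D
          (λ J → meas-open λ y (β , j , d) → let (γ , N⊆D) = D-open β y d in γ , λ z p → β , j , N⊆D z p)
          D-null D-nonnull κ≤ƛ
        where
        D : ∣ κ ∣ → El X → Set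
        D β y = N x α y × N x β y × proj₁ x β ≢ proj₁ y β

        D-disjoint : Disjoint D
        D-disjoint β γ β≢γ y (_ , p , xβ≢yβ) (_ , q , xγ≢yγ) with κ.compare β γ
        ... | tri< β<γ _ _ = xβ≢yβ (q β β<γ)
        ... | tri≈ _ eq _  = β≢γ eq
        ... | tri> _ _ γ<β = xγ≢yγ (p γ γ<β)

        D-open : ∀ β → IsOpen (D β)
        D-open β y (p , q , x≢y) with upper-bound α β
        ... | γ , α<γ , β<γ = γ , λ z r →
          N-trans x y z α p (N-antitone y z α<γ r) , N-trans x y z β q (N-antitone y z β<γ r) ,
          λ eq → x≢y (trans eq (sym (r β β<γ)))

        meas-D : ∀ β → Meas (D β)
        meas-D β = meas-open (D-open β)

        D-null : ∀ β → Null (D β)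
        -- A point that differs from `x` at `β` has left the cone of any level `γ` above `β`; `γ` is
        -- taken above `α` too, so that `null` applies.
        D-null β with upper-bound α β
        ... | γ , α<γ , β<γ = null-mono (meas-Diff α<γ)
          (λ y (p , _ , x≢y) → p , λ q → x≢y (q β β<γ)) (null γ α<γ)

        D-nonnull : ¬ Null (λ y → ∃[ β ] D β y)
        D-nonnull nullD = ¬negligible⇒nonnull ¬negligible α
          (null-∪-disjoint {ƛ} above C (meas-point x)
            (meas-open λ y (β , d) → let (γ , N⊆D) = D-open β y d in γ , λ z p → β , N⊆D z p)
            (λ where _ refl (β , _ , _ , x≢x) → x≢x refl)
            split (null-point x) nullD)
          where
          split : ∀ y → N x α y → y ≡ x ⊎ (∃[ β ] D β y)
          split y p with lem (y ≡ x)
          ... | inj₁ y≡x = inj₁ y≡x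
          ... | inj₂ y≢x with CardinalOrder.least κ (λ i → proj₁ x i ≢ proj₁ y i)
                                (¬∀⇒∃¬ λ eq → y≢x (sym (El-≡ (ext eq))))
          ... | β , x≢y , agree = inj₂ (β , p , (λ i i<β → dne (agree i i<β)) , x≢y)

      measurable-from-branch : IsMeasurable ƛ
      measurable-from-branch = spread⇒measurable (proj₁ null-differences) (proj₂ null-differences)

    module CountableHeight (countable : ∣ κ ∣ ↣ ℕ) where

      IsBigCone : ∣ κ ∣ → ℕ → 𝒫 (El X) → Set
      IsBigCone α k B = ∃[ x ] (B ≡ ⟪ N x α ⟫ × Big k (N x α))

      BigCone : ∣ κ ∣ → ℕ → Set
      BigCone α k = El ⟪ IsBigCone α k ⟫

      bigCone : ∀ {α k} x → Big k (N x α) → BigCone α k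
      bigCone {α} {k} x big = ⟪ N x α ⟫ , ∈-intro (IsBigCone α k) {⟪ N x α ⟫} (x , refl , big)

      -- Distinct cones of one level are disjoint, so by `exhaustive` only finitely many exceed
      -- 1/(k+1).
      rank : ∀ α k → BigCone α k ↣ ℕ
      rank α k with ℕ-Order.embeds-or-enumerates (BigCone α k)
      ... | inj₂ (n , enum) = El-↣ _ ↣-∘ Bijection.injection (⤖-sym enum)
      ... | inj₁ ℕ↣S = ⊥-elim (exhaustive A A-disjoint (λ n → proj₂ (proj₂ (cone-of n))))
        where
        open Injection ℕ↣S using (to; injective)

        cone-of : ∀ n → IsBigCone α k (proj₁ (to n))
        cone-of n = ∈-elim (IsBigCone α k) {proj₁ (to n)} (proj₂ (to n))

        A : ℕ → El X → Set
        A n = N (proj₁ (cone-of n)) α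

        A-disjoint : Disjoint A
        A-disjoint m n m≢n z p q = m≢n (injective (El-≡ (trans (proj₁ (proj₂ (cone-of m)))
          (trans (⟪⟫-cong (λ y → N-trans b a y α (N-trans b z a α q (N-sym a z α p)))
                          (λ y → N-trans a b y α (N-trans a z b α p (N-sym b z α q))))
                 (sym (proj₁ (proj₂ (cone-of n))))))))
          where
          a = proj₁ (cone-of m)
          b = proj₁ (cone-of n)

      Kernel : 𝒫 (El X)
      Kernel = ⟪ (λ x → ¬ Negligible x) ⟫

      -- A point is described by the level, threshold and rank of each big cone around it. For
      -- countable `κ` there are only countably many such triples.
      Code : El X → ∣ κ ∣ × ℕ × ℕ → Set
      Code x (α , k , j) = ∃[ b ] Injection.to (rank α k) (bigCone x b) ≡ j

      -- A kernel point has non-null cones at all levels, so its code has a triple for each level;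
      -- sharing that triple means sharing the cone.
      code-injective : {x y : El Kernel} → ⟪ Code (proj₁ x) ⟫ ≡ ⟪ Code (proj₁ y) ⟫ → x ≡ y
      code-injective {x , x∈} {y , _} eq = El-≡ (El-≡ (ext λ i →
        -- Coordinate `i` is fixed only by cones of a level above `i`.
        let (α , i<α) = κ-unbounded i in agree α i i<α))
        where
        agree : ∀ α → N x α y
        agree α with ¬null⇒big (¬negligible⇒nonnull (∈-elim (λ x → ¬ Negligible x) {x} x∈) α)
        ... | k , b with ∈-elim (Code y) (subst (c ∈_) eq (∈-intro (Code x) {c} (b , refl)))
          where c = α , k , Injection.to (rank α k) (bigCone x b)
        ... | b′ , same-rank = ∈-elim (N x α) {y} (subst (y ∈_)
          (cong proj₁ (Injection.injective (rank α k) same-rank))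
          (∈-intro (N y α) {y} (N-refl y α)))

      code-index : (∣ κ ∣ × ℕ × ℕ) ↣ ℕ
      code-index = mk↣ {to = λ (α , kj) → square-pair (Injection.to countable α , square-pair kj)} λ eq →
        let eq′ = square-pair-injective eq in
        cong₂ _,_ (Injection.injective countable (cong proj₁ eq′)) (square-pair-injective (cong proj₂ eq′))

      Kernel-small : ¬ (∣ ƛ ∣ ↣ El Kernel)
      Kernel-small λ↣K = proj₂ above
        (𝒫-↣ code-index ↣-∘ (mk↣ {to = λ x → ⟪ Code (proj₁ x) ⟫} code-injective ↣-∘ λ↣K))

      negligible-nonnull : ¬ Null Negligible
      negligible-nonnull null = nonnull (null-∪-disjoint {ƛ} above C
        meas-negligible (meas-⋃ Kernel-small point (meas-point ∘ proj₁))
        (λ x neg → λ where (s , refl) → ∈-elim (λ x → ¬ Negligible x) {x} (proj₂ s) neg)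
        (λ x _ → split x (lem (Negligible x)))
        null
        (null-⋃ Kernel-small point (meas-point ∘ proj₁) point-disjoint (null-point ∘ proj₁)))
        where
        point : El Kernel → El X → Set
        point s x = x ≡ proj₁ s

        point-disjoint : Disjoint point
        point-disjoint s t s≢t x p q = s≢t (El-≡ (trans (sym p) q))

        split : ∀ x → Negligible x ⊎ ¬ Negligible x → Negligible x ⊎ (∃[ s ] point s x)
        split x (inj₁ neg)  = inj₁ neg
        split x (inj₂ ¬neg) = inj₂ ((x , ∈-intro (λ x → ¬ Negligible x) {x} ¬neg) , refl)

    measurable : IsMeasurable ƛ
    measurable with lem (Null Negligible)
    ... | inj₂ ¬null = measurable-from-cells ¬null
    ... | inj₁ null with lem (∣ κ ∣ ↣ ℕ)
    ... | inj₁ countable = ⊥-elim (CountableHeight.negligible-nonnull countable null)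
    ... | inj₂ uncountable with ¬∀⇒∃¬ (λ all → nonnull (null-mono meas-negligible (λ x _ → all x) null))
    ... | x , ¬neg = UncountableHeight.measurable-from-branch uncountable x ¬neg

  module _ (κ ƛ : InfiniteCardinal) (κ≤ƛ : κ ≤ᶜ ƛ) (regular : IsRegular κ)
    (above : AboveContinuum ƛ) (X : 𝒫 (Seq κ ƛ)) (weight : HasWeight (space κ ƛ X) ƛ)
    {𝔐 dom : 𝒫 (𝒫 (El X))} {μ : (A : 𝒫 (El X)) → A ∈ dom → [0,1]} where

    measurable-from-measure : IsContinuousWeakMeasureSpace ƛ (space κ ƛ X) 𝔐 dom μ → IsMeasurable ƛ
    measurable-from-measure continuous =
      MeasurableFromSpace.measurable κ ƛ κ≤ƛ regular above X weight content
        (λ {P} P-open → open⊆𝔐 ⟪ P ⟫ (Cones.open-intro κ ƛ X P-open))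
        singleton∈𝔐
        (λ x k (m , e) → null-elim (measure ｛ x ｝ (singleton∈𝔐 x)) (proj₁ (singleton-null x)) k
          (subst (λ m → ε k ∈ [0,∞].cut (measure ｛ x ｝ m)) (T-irrelevant m (singleton∈𝔐 x)) e))
        nonnull
      where
      open IsContinuousWeakMeasureSpace continuous
        using (isWeakMeasureSpace; measure; open⊆𝔐; singleton∈𝔐; singleton-null)
      open MeasureContent {ƛ} above isWeakMeasureSpace using (content; nonnull)

  -- From an ultrafilter to a measure

  -- The condition compares indices, so `g` is injective. It is asked at every point of the space
  -- because each point needs a null neighbourhood for `M5`.
  IsDiscreteFamily : {I X : Set} → Topology X → (I → X) → Set
  IsDiscreteFamily {I} {X} τ g = ∀ x → ∃[ V ] (V ∈ Topology.opens τ × x ∈ V ×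
    (∀ {i j} → g i ∈ V → g j ∈ V → i ≡ j))

  module MeasureFromUltrafilter (ƛ : InfiniteCardinal) {X : Set} (τ : Topology X)
    (g : ∣ ƛ ∣ → X) (discrete : IsDiscreteFamily τ g)
    (𝒰 : 𝒫 (𝒫 ∣ ƛ ∣)) (isUltrafilter : IsUltrafilter 𝒰) (nonprincipal : ¬ IsPrincipal 𝒰)
    (complete : IsComplete ƛ 𝒰) where
    open IsUltrafilter isUltrafilter

    preimage : 𝒫 (X) → 𝒫 ∣ ƛ ∣
    preimage A i = A (g i)

    Large : 𝒫 (X) → Set
    Large A = preimage A ∈ 𝒰

    large-mono : ∀ A B → A ⊆ B → Large A → Large B
    large-mono A B A⊆B = upward (preimage A) (preimage B) (λ i → A⊆B (g i))

    empty∉𝒰 : ∀ B → (∀ i → i ∉ B) → B ∉ 𝒰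
    empty∉𝒰 B ∉B B∈ = ∅∉ (upward B ∅ (λ i i∈B → ⊥-elim (∉B i i∈B)) B∈)

    large-meet : ∀ {B C} → B ∈ 𝒰 → C ∈ 𝒰 → ∃[ i ] (i ∈ B × i ∈ C)
    large-meet {B} {C} B∈ C∈ = dne λ ¬∃ → empty∉𝒰 (B ∩ C)
      (λ i i∈ → ¬∃ (i , ∈-elim (λ i → i ∈ B × i ∈ C) i∈)) (∩∈ B C B∈ C∈)

    -- The preimage of `V` has at most one index, and an ultrafilter with a one-element member is
    -- principal.
    discrete-not-large : ∀ V → (∀ {i j} → g i ∈ V → g j ∈ V → i ≡ j) → ¬ Large V
    discrete-not-large V separated large =
      let (a , ga∈V , _) = large-meet {preimage V} {preimage V} large large in
      nonprincipal (a , λ C → mk⇔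
        (λ C∈ → let (c , gc∈V , c∈C) = large-meet {preimage V} {C} large C∈ in
          subst (_∈ C) (separated gc∈V ga∈V) c∈C)
        (λ a∈C → upward (preimage V) C
          (λ i gi∈V → subst (_∈ C) (separated ga∈V gi∈V) a∈C) large))

    point-not-large : ∀ x → ¬ Large ｛ x ｝
    point-not-large x large = let (V , _ , x∈V , separated) = discrete x in
      discrete-not-large V separated (large-mono ｛ x ｝ V
        (λ y y∈ → subst (_∈ V) (sym (∈-elim (λ y → y ≡ x) {y} y∈)) x∈V) large)

    large-disjoint : ∀ {A B} → Large A → Large B → ¬ (∀ x → ¬ (x ∈ A × x ∈ B))
    large-disjoint {A} {B} lA lB disjoint =
      let (i , p , q) = large-meet {preimage A} {preimage B} lA lB in disjoint (g i) (p , q)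

    -- If no piece were large, completeness would put the intersection of the complements into `𝒰`,
    -- but it misses the preimage of the union.
    large-⋃ : ∀ γ (A : Below ƛ γ → 𝒫 (X)) → Large (⋃ A) → ∃[ i ] Large (A i)
    large-⋃ γ A large = dne λ ¬∃ →
      let co-large : ∀ i → ∁ (preimage (A i)) ∈ 𝒰
          co-large i = co (ultra (preimage (A i))) (λ l → ¬∃ (i , l))
          (j , gj∈⋃ , j∈⋂) = large-meet {preimage (⋃ A)} {⋂ (λ i → ∁ (preimage (A i)))} large
                               (complete γ (λ i → ∁ (preimage (A i))) co-large)
          (i , gj∈A) = ∈-elim (λ x → ∃[ i ] x ∈ A i) {g j} gj∈⋃
      in ∈-elim (λ k → k ∉ preimage (A i)) {j}
           (∈-elim (λ k → ∀ i → k ∈ ∁ (preimage (A i))) {j} j∈⋂ i) gj∈A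
      where
      co : ∀ {B C : Set} → B ⊎ C → ¬ B → C
      co (inj₁ b) ¬b = ⊥-elim (¬b b)
      co (inj₂ c) _  = c

    -- The decision is an argument so that case analysis on `lem (Large A)` computes `μ A`.
    value : {P : Set} → P ⊎ ¬ P → [0,1]
    value (inj₁ _) = 𝟙 , λ _ → id
    value (inj₂ _) = 𝟘 , 𝟘≤ 𝟙

    μ : 𝒫 (X) → [0,1]
    μ A = value (lem (Large A))

    m : 𝒫 (X) → [0,∞]
    m A = proj₁ (μ A)

    large⇒𝟙 : ∀ A → Large A → 𝟙 ≤ m A
    large⇒𝟙 A large with lem (Large A)
    ... | inj₁ _  = λ _ → id
    ... | inj₂ ¬l = ⊥-elim (¬l large)

    ¬large⇒𝟘 : ∀ A → ¬ Large A → m A ≤ 𝟘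
    ¬large⇒𝟘 A ¬large with lem (Large A)
    ... | inj₁ l = ⊥-elim (¬large l)
    ... | inj₂ _ = λ _ → id

    m-mono : ∀ A B → (Large A → Large B) → m A ≤ m B
    m-mono A B A⇒B = by-cases (lem (Large A))
      where
      by-cases : Large A ⊎ ¬ Large A → m A ≤ m B
      by-cases (inj₁ l)  = ≤-trans {m A} {𝟙} {m B} (proj₂ (μ A)) (large⇒𝟙 B (A⇒B l))
      by-cases (inj₂ ¬l) = ≤-trans {m A} {𝟘} {m B} (¬large⇒𝟘 A ¬l) (𝟘≤ (m B))

    -- Two large sets meet, so at most one piece has value `𝟙`; if none has, the union is not large
    -- either, by `large-⋃`.
    additive : ∀ γ (A : Below ƛ γ → 𝒫 (X)) → (∀ i j → i ≢ j → ∀ x → ¬ (x ∈ A i × x ∈ A j)) →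
               m (⋃ A) ≈ ∑ (m ∘ A)
    additive γ A disjoint = by-cases (lem (∃[ i ] Large (A i)))
      where
      by-cases : (∃[ i ] Large (A i)) ⊎ ¬ (∃[ i ] Large (A i)) → m (⋃ A) ≈ ∑ (m ∘ A)
      by-cases (inj₁ (i , large)) =
        (≤-trans {m (⋃ A)} {𝟙} {∑ (m ∘ A)} (proj₂ (μ (⋃ A)))
          (≤-trans {𝟙} {m (A i)} {∑ (m ∘ A)} (large⇒𝟙 (A i) large)
            (≤-trans {m (A i)} {m (A i) + 𝟘} {∑ (m ∘ A)} (≤-+𝟘 (m (A i)))
              (total≤∑ (m ∘ A) (i ∷ []) ([] ∷ []))))) ,
        ∑≤ (m ∘ A) (m (⋃ A)) (total-single (m ∘ A) (m (⋃ A)) i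
          (m-mono (A i) (⋃ A) (large-mono (A i) (⋃ A) λ x x∈ → ∈-intro (λ x → ∃[ i ] x ∈ A i) {x} (i , x∈)))
          (λ j j≢i → ¬large⇒𝟘 (A j) λ large′ → large-disjoint {A j} {A i} large′ large (disjoint j i j≢i)))
      by-cases (inj₂ ¬∃) =
        ≤-trans {m (⋃ A)} {𝟘} {∑ (m ∘ A)} (¬large⇒𝟘 (⋃ A) (¬∃ ∘ large-⋃ γ A)) (𝟘≤ (∑ (m ∘ A))) ,
        ≤-trans {∑ (m ∘ A)} {𝟘} {m (⋃ A)}
          (∑-null (m ∘ A) λ i → ¬large⇒𝟘 (A i) λ l → ¬∃ (i , l)) (𝟘≤ (m (⋃ A)))

    point-null : ∀ x → m ｛ x ｝ ≤ 𝟘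
    point-null x = ¬large⇒𝟘 ｛ x ｝ (point-not-large x)

    inf-null : ∀ {I : Set} x (A : I → 𝒫 X) → IsLocalBasis τ x A → ⨅ (m ∘ A) ≤ 𝟘
    inf-null x A (_ , basis) =
      let (V , V∈ , x∈V , separated) = discrete x
          (i , Ai⊆V)                 = basis V V∈ x∈V
      in ≤-trans {⨅ (m ∘ A)} {m (A i)} {𝟘} (⨅≤ (m ∘ A) i)
           (¬large⇒𝟘 (A i) (discrete-not-large V separated ∘ large-mono (A i) V Ai⊆V))

    ∈full : {A : Set} (x : A) → x ∈ full
    ∈full x = ∈-intro (λ _ → ⊤) {x} tt

    isContinuous : IsContinuousWeakMeasureSpace ƛ τ full full (λ A _ → μ A)
    isContinuous = record
      { isWeakMeasureSpace = record
        { open⊆𝔐 = λ U _ → ∈full U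
        ; 𝔐-⋃    = λ γ A _ → ∈full (⋃ A)
        ; 𝔐⊆dom  = λ _ → id
        ; M1     = ¬large⇒𝟘 ∅ (empty∉𝒰 (preimage ∅) λ i → ∈-elim (λ _ → ⊥) {g i}) , 𝟘≤ (m ∅)
        ; M2     = λ full≤0 → 𝟙≰𝟘 (≤-trans {𝟙} {m full} {𝟘} (large⇒𝟙 full full-large) full≤0)
        ; M3     = λ A B _ _ A⊆B → m-mono A B (large-mono A B A⊆B)
        ; M4     = λ γ A _ disjoint → additive γ A disjoint
        ; M5     = λ x _ γ A basis →
            ≤-trans {m ｛ x ｝} {𝟘} {⨅ (m ∘ A)} (point-null x) (𝟘≤ (⨅ (m ∘ A))) ,
            ≤-trans {⨅ (m ∘ A)} {𝟘} {m ｛ x ｝} (inf-null x A basis) (𝟘≤ (m ｛ x ｝))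
        }
      ; singleton∈𝔐    = λ x → ∈full ｛ x ｝
      ; singleton-null = λ x → point-null x , 𝟘≤ (m ｛ x ｝)
      }
      where
      full-large : Large full
      full-large = upward full (preimage full) (λ i _ → ∈full (g i)) full∈

  -- Discrete families from covers without small subcovers.

  module DiscreteFamily (κ ƛ : InfiniteCardinal) (X : 𝒫 (Seq κ ƛ))
    (weight : HasWeight (space κ ƛ X) ƛ) (𝒞 : 𝒫 (𝒫 (El X)))
    (𝒞-open : 𝒞 ⊆ Topology.opens (space κ ƛ X)) (𝒞-covers : Covers 𝒞)
    (no-small-subcover : ¬ (∃[ 𝒱 ] (𝒱 ⊆ 𝒞 × Covers 𝒱 × El 𝒱 ≺ ∣ ƛ ∣))) where
    open Cones κ ƛ X
    open MaximalCones (λ x α → ∃[ U ] (U ∈ 𝒞 × (∀ y → N x α y → y ∈ U)))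
      (λ {x} {y} {α} p (U , U∈ , N⊆U) → U , U∈ , λ z → N⊆U z ∘ N-trans x y z α p)

    cell-at : ∀ x → ∃[ B ] B ∋ x
    cell-at x = let (U , U∈ , x∈U) = 𝒞-covers x
                    (α , N⊆U)     = open-elim U (𝒞-open U U∈) x x∈U
                in cell-exists (U , U∈ , N⊆U)

    cover-of : ∀ B → ∃[ U ] (U ∈ 𝒞 × proj₁ B ⊆ U)
    cover-of B = let (x , α , (U , U∈ , N⊆U) , B≡) = cell-Q B in
      U , U∈ , λ y y∈B → N⊆U y (∈-elim (N x α) {y} (subst (y ∈_) B≡ y∈B))

    Chosen : 𝒫 (El X) → Set
    Chosen U = ∃[ B ] proj₁ (cover-of B) ≡ U

    cell-of : (U : El ⟪ Chosen ⟫) → Chosen (proj₁ U)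
    cell-of (U , U∈) = ∈-elim Chosen {U} U∈

    -- The cover members picked for the cells still cover the space, so they cannot be fewer than
    -- `ƛ`; each of them determines a cell that it was picked for.
    λ↣cells : ∣ ƛ ∣ ↣ Cell
    λ↣cells = chosen↣cells ↣-∘ dne λ ¬λ↣chosen → no-small-subcover
      (⟪ Chosen ⟫ , chosen⊆𝒞 , chosen-covers , cells-≤-weight weight ↣-∘ chosen↣cells , ¬λ↣chosen)
      where
      chosen↣cells : El ⟪ Chosen ⟫ ↣ Cell
      chosen↣cells = mk↣ {to = proj₁ ∘ cell-of} λ {U} {V} eq →
        El-≡ (trans (sym (proj₂ (cell-of U))) (trans (cong (proj₁ ∘ cover-of) eq) (proj₂ (cell-of V))))

      chosen⊆𝒞 : ⟪ Chosen ⟫ ⊆ 𝒞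
      chosen⊆𝒞 U U∈ = let (B , eq) = ∈-elim Chosen {U} U∈ in
        subst (_∈ 𝒞) eq (proj₁ (proj₂ (cover-of B)))

      chosen-covers : Covers ⟪ Chosen ⟫
      chosen-covers x = let (B , x∈B) = cell-at x
                            (U , _ , B⊆U) = cover-of B
                        in U , ∈-intro Chosen {U} (B , refl) , B⊆U x x∈B

    discrete-family : ∃[ g ] IsDiscreteFamily {∣ ƛ ∣} (space κ ƛ X) g
    discrete-family = (λ i → proj₁ (centre (to i))) , λ x →
      let (B , x∈B) = cell-at x in
      proj₁ B , cell∈opens B , x∈B , λ {i} {j} gi∈B gj∈B → injective
        (trans (cell-unique (to i) B _ (proj₂ (centre (to i))) gi∈B)
               (cell-unique B (to j) _ gj∈B (proj₂ (centre (to j)))))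
      where open Injection λ↣cells using (to; injective)

  -- The discrete space of constant sequences.

  module ConstantSequences (κ ƛ : InfiniteCardinal) where

    IsConstant : Seq κ ƛ → Set
    IsConstant z = ∃[ a ] z ≡ (λ _ → a)

    Constants : 𝒫 (Seq κ ƛ)
    Constants = ⟪ IsConstant ⟫

    open Cones κ ƛ Constants using (open-intro)

    private
      τ = space κ ƛ Constants
      -- A cone of level `γ` fixes the coordinate `i₀` below it, which is enough to isolate a
      -- constant sequence.
      γ = proj₁ (inhabited-segment κ)
      i₀ = proj₁ (proj₂ (inhabited-segment κ))
      i₀<γ = ∈-elim (λ i → InfiniteCardinal._<_ κ i γ) (proj₂ (proj₂ (inhabited-segment κ)))

    c : ∣ ƛ ∣ → El Constants
    c a = (λ _ → a) , ∈-intro IsConstant {λ _ → a} (a , refl)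

    c-surjective : ∀ x → ∃[ a ] c a ≡ x
    c-surjective (z , z∈) = let (a , eq) = ∈-elim IsConstant {z} z∈ in a , El-≡ (sym eq)

    determined : ∀ x y → proj₁ x i₀ ≡ proj₁ y i₀ → x ≡ y
    determined x y eq with c-surjective x | c-surjective y
    ... | a , refl | b , refl = cong c eq

    c-injective : ∀ {a b} → c a ≡ c b → a ≡ b
    c-injective = cong (λ x → proj₁ x i₀)

    ∈｛｝ : (x : El Constants) → x ∈ ｛ x ｝
    ∈｛｝ x = ∈-intro (λ y → y ≡ x) {x} refl

    ∈｛｝⇒≡ : {x y : El Constants} → y ∈ ｛ x ｝ → y ≡ x
    ∈｛｝⇒≡ {x} {y} = ∈-elim (λ y → y ≡ x) {y}

    ｛｝-open : ∀ x → ｛ x ｝ ∈ Topology.opens τ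
    ｛｝-open x = open-intro {λ y → y ≡ x} λ where
      _ refl → γ , λ y p → determined y x (sym (p i₀ i₀<γ))

    -- Such a `W` is the singleton of `c a`. Bases and subcovers of the singletons both contain
    -- these sets, which gives the weight bound and the failure of the Lindelöf property.
    separating-↣ : (𝒲 : 𝒫 (𝒫 (El Constants))) →
                   (∀ a → ∃[ W ] (W ∈ 𝒲 × c a ∈ W × W ⊆ ｛ c a ｝)) → ∣ ƛ ∣ ↣ El 𝒲
    separating-↣ 𝒲 W = mk↣ {to = λ a → proj₁ (W a) , proj₁ (proj₂ (W a))} λ {a} {b} eq →
      let (_ , _ , a∈ , _) = W a
          (_ , _ , _ , ⊆b) = W b
      in c-injective (∈｛｝⇒≡ {c b} {c a} (⊆b (c a) (subst (c a ∈_) (cong proj₁ eq) a∈)))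

    IsSingleton : 𝒫 (El Constants) → Set
    IsSingleton B = ∃[ a ] B ≡ ｛ c a ｝

    Singletons : 𝒫 (𝒫 (El Constants))
    Singletons = ⟪ IsSingleton ⟫

    singleton : ∣ ƛ ∣ → El Singletons
    singleton a = ｛ c a ｝ , ∈-intro IsSingleton {｛ c a ｝} (a , refl)

    singletons-open : Singletons ⊆ Topology.opens τ
    singletons-open B B∈ with ∈-elim IsSingleton {B} B∈
    ... | a , refl = ｛｝-open (c a)

    singletons-cover : ∀ x → ∃[ a ] x ∈ ｛ c a ｝
    singletons-cover x with c-surjective x
    ... | a , refl = a , ∈｛｝ (c a)

    weight : HasWeight τ ƛ
    weight = (Singletons , (singletons-open , union) , mk⤖ {to = singleton} (injective , surjective)) , minimal
      where
      ｛｝⊆ : ∀ a x U → x ∈ ｛ c a ｝ → x ∈ U → ｛ c a ｝ ⊆ U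
      ｛｝⊆ a x U x∈ x∈U y y∈ = subst (_∈ U) (trans (∈｛｝⇒≡ {c a} {x} x∈) (sym (∈｛｝⇒≡ {c a} {y} y∈))) x∈U

      union : ∀ U → U ∈ Topology.opens τ → UnionOf {El Singletons} proj₁ U
      union U _ x x∈U = let (a , x∈) = singletons-cover x in singleton a , x∈ , ｛｝⊆ a x U x∈ x∈U

      injective : ∀ {a b} → singleton a ≡ singleton b → a ≡ b
      injective {a} {b} eq = c-injective (∈｛｝⇒≡ {c b} {c a} (subst (c a ∈_) (cong proj₁ eq) (∈｛｝ (c a))))

      surjective : ∀ B → ∃[ a ] (∀ {b} → b ≡ a → singleton b ≡ B)
      surjective (B , B∈) = let (a , B≡) = ∈-elim IsSingleton {B} B∈ in
        a , λ where refl → El-≡ (sym B≡)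

      minimal : ∀ ℬ → IsBase τ ℬ → ∣ ƛ ∣ ↣ El ℬ
      minimal ℬ (_ , base) = separating-↣ ℬ λ a →
        let ((W , W∈) , a∈W , W⊆) = base ｛ c a ｝ (｛｝-open (c a)) (c a) (∈｛｝ (c a))
        in W , W∈ , a∈W , W⊆

    not-Lindelöf : ¬ IsLindelöf ƛ τ
    not-Lindelöf lindelöf =
      let (𝒱 , 𝒱⊆ , covers , _ , ¬λ↣𝒱) = lindelöf Singletons singletons-open
            (λ x → let (a , x∈) = singletons-cover x in proj₁ (singleton a) , proj₂ (singleton a) , x∈)
      in ¬λ↣𝒱 (separating-↣ 𝒱 λ a →
        let (U , U∈ , a∈U) = covers (c a)
            (b , U≡)       = ∈-elim IsSingleton {U} (𝒱⊆ U U∈)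
            a≡b            = ∈｛｝⇒≡ {c b} {c a} (subst (c a ∈_) U≡ a∈U)
        in U , U∈ , a∈U , subst (λ x → U ⊆ ｛ x ｝) (sym a≡b) (λ x x∈U → subst (x ∈_) U≡ x∈U))

corollary7p3 : (em : ExcludedMiddle 0ℓ) → Extensionality 0ℓ 0ℓ →
    let open Classical em in
    (κ ƛ : InfiniteCardinal) → κ ≤ᶜ ƛ → IsRegular κ → AboveContinuum ƛ →
    let
      statement₁ : Set
      statement₁ =
        Σ[ X ∈ 𝒫 (Seq κ ƛ) ] (HasWeight (space κ ƛ X) ƛ ×
          (∃[ 𝔐 ] ∃[ dom ] ∃[ μ ] IsContinuousWeakMeasureSpace ƛ (space κ ƛ X) 𝔐 dom μ))

      statement₂ : Set
      statement₂ =
        (X : 𝒫 (Seq κ ƛ)) → HasWeight (space κ ƛ X) ƛ → ¬ IsLindelöf ƛ (space κ ƛ X) →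
        Σ[ μ ∈ (𝒫 (El X) → [0,1]) ]
          IsContinuousWeakMeasureSpace ƛ (space κ ƛ X) full full (λ A _ → μ A)

      statement₃ : Set
      statement₃ = IsMeasurable ƛ
    in
    (statement₁ ⇔ statement₂) × (statement₂ ⇔ statement₃)
corollary7p3 em ext κ ƛ κ≤ƛ regular above =
  -- The cycle from 1 to 3 to 2 to 1 yields all four implications.
  mk⇔ (λ s₁ → 3⇒2 (1⇒3 s₁)) 2⇒1 , mk⇔ (λ s₂ → 1⇒3 (2⇒1 s₂)) 3⇒2
  where
  open Classical em
  open ClassicalLogic em ext

  Statement₁ Statement₂ : Set
  Statement₁ = Σ[ X ∈ 𝒫 (Seq κ ƛ) ] (HasWeight (space κ ƛ X) ƛ ×
    (∃[ 𝔐 ] ∃[ dom ] ∃[ μ ] IsContinuousWeakMeasureSpace ƛ (space κ ƛ X) 𝔐 dom μ))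
  Statement₂ = (X : 𝒫 (Seq κ ƛ)) → HasWeight (space κ ƛ X) ƛ → ¬ IsLindelöf ƛ (space κ ƛ X) →
    Σ[ μ ∈ (𝒫 (El X) → [0,1]) ]
      IsContinuousWeakMeasureSpace ƛ (space κ ƛ X) full full (λ A _ → μ A)

  1⇒3 : Statement₁ → IsMeasurable ƛ
  1⇒3 (X , weight , _ , _ , _ , continuous) =
    measurable-from-measure κ ƛ κ≤ƛ regular above X weight continuous

  2⇒1 : Statement₂ → Statement₁
  2⇒1 s₂ = let (μ , continuous) = s₂ Constants weight not-Lindelöf in
    Constants , weight , full , full , (λ A _ → μ A) , continuous
    where open ConstantSequences κ ƛ

  3⇒2 : IsMeasurable ƛ → Statement₂
  3⇒2 (_ , 𝒰 , isUltrafilter , nonprincipal , complete) X weight ¬lindelöf =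
    -- `IsLindelöf` is an implication for each `𝒞`; where it fails, `𝒞` is open and covering by
    -- double negation, and the conclusion is refuted.
    let (𝒞 , ¬subcover) = ¬∀⇒∃¬ ¬lindelöf
        (g , discrete) = DiscreteFamily.discrete-family κ ƛ X weight 𝒞
          (dne λ ¬open → ¬subcover λ 𝒞-open → ⊥-elim (¬open 𝒞-open))
          (dne λ ¬covers → ¬subcover λ _ covers → ⊥-elim (¬covers covers))
          (λ subcover → ¬subcover λ _ _ → subcover)
        open MeasureFromUltrafilter ƛ (space κ ƛ X) g discrete 𝒰 isUltrafilter nonprincipal complete
    in μ , isContinuous
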